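{- Let $G_{48}$ be the graph on vertex set $\{0,1,\dots,47\}$ with the following $50$ edges: $(0,1)$, $(0,2)$, $(0,3)$, $(1,5)$, $(1,12)$, $(1,13)$, $(2,12)$, $(3,16)$, $(3,24)$, $(4,5)$, $(4,6)$, $(5,7)$, $(5,8)$, $(6,31)$, $(7,25)$, $(9,10)$, $(9,11)$, $(11,14)$, $(11,15)$, $(13,22)$, $(13,28)$, $(14,26)$, $(15,27)$, $(16,17)$, $(17,29)$, $(17,30)$, $(18,19)$, $(19,20)$, $(20,31)$, $(21,22)$, $(21,23)$, $(24,43)$, $(25,26)$, $(26,27)$, $(28,32)$, $(29,37)$, $(30,38)$, $(30,39)$, $(32,46)$, $(33,34)$, $(33,35)$, $(34,36)$, $(36,43)$, $(37,39)$, $(38,40)$, $(38,41)$, $(40,42)$, $(41,44)$, $(44,45)$, $(46,47)$. Then $G_{48}$ is connected and triangle-free, with maximum degree $4$, cycle rank $3$, and minimum cycle basis of lengths $(4,5,5)$. Its line graph $L(G_{48})$ has $50$ vertices and inertia $\mathrm{In}(L(G_{48})) = (26,0,24)$, hence $s(L(G_{48})) = 2$.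
   Context: All graphs are finite and simple. For a graph $H$ with adjacency matrix $A(H)$, $n^{+}(H)$, $n^{0}(H)$, $n^{ - }(H)$ denote the numbers of positive, zero and negative eigenvalues of $A(H)$, counted with multiplicity; the inertia is $\mathrm{In}(H) = (n^{+}(H), n^{0}(H), n^{ - }(H))$ and the signature is $s(H) = n^{+}(H) - n^{ - }(H)$. The line graph $L(G)$ has the edges of $G$ as vertices, two being adjacent when they are distinct and share an endpoint. The cycle rank of a connected graph with $n$ vertices and $m$ edges is $m-n+1$, the dimension over $\mathbb{F}_2$ of its cycle space; a minimum cycle basis is a basis of the cycle space consisting of cycles with minimum total length. -}

module Defs where

open import Algebra.Bundles using (CommutativeRing)
import Algebra.Definitions.RawMonoid as RawMonoidDefs
open import Data.Bool.Base using (Bool; false; if_then_else_)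
open import Data.Bool.Properties using (xor-∧-commutativeRing)
open import Data.Fin.Base using (Fin; toℕ)
import Data.Fin.Base as Fin
import Data.Fin.Properties as Fin
open import Data.Integer.Base using (ℤ; +_; _⊖_)
import Data.Integer.Base as ℤ
open import Data.List.Base
  using (List; []; _∷_; _∷ʳ_; length; lookup; map; filter; zip; allFin; cartesianProduct; foldr)
import Data.List.Base as List
open import Data.List.Relation.Unary.All using (All; all?)
import Data.List.Relation.Unary.All as All
open import Data.List.Relation.Unary.Any using (any?)
open import Data.List.Relation.Unary.Unique.Propositional using (Unique)
open import Data.List.Membership.Propositional using (_∈_)
import Data.List.Membership.DecPropositional as DecMembership
open import Data.Nat.Base using (ℕ; _⊔_)
import Data.Nat.Base as ℕ
import Data.Nat.ListAction as ℕ
import Data.Nat.Properties as ℕ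
open import Data.Product.Base using (Σ; ∃-syntax; _×_; _,_; proj₁; proj₂)
open import Data.Product.Properties using (≡-dec)
open import Data.Sum.Base using (_⊎_; swap; [_,_]′)
open import Data.Vec.Functional using (Vector)
import Data.Vec.Functional.Relation.Binary.Equality.Setoid as VecEq
open import Level using (0ℓ)
open import Relation.Binary.Core using (Rel)
open import Relation.Binary.Construct.Closure.ReflexiveTransitive using (Star)
open import Relation.Binary.Definitions
  using (Cotransitive; Decidable; Irreflexive; Symmetric)
open import Relation.Binary.PropositionalEquality.Core using (_≡_; _≢_; refl; sym)
open import Relation.Binary.Structures using (IsStrictPartialOrder)
open import Relation.Nullary.Decidable.Core
  using (does; _×-dec_; _⊎-dec_; ¬?; toWitness)
open import Relation.Nullary.Negation.Core using (¬_)
open import Relation.Unary using (Pred)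

------------------------------------------------------------------------
-- Linear algebra over a commutative ring (used over ℝ and over 𝔽₂)

module LinearAlgebra {c ℓ} (R : CommutativeRing c ℓ) where
  open CommutativeRing R
  open RawMonoidDefs +-rawMonoid using (sum) public
  open VecEq setoid using (_≋_) public

  Matrix : ℕ → Set c
  Matrix n = Fin n → Fin n → Carrier

  0v : ∀ {n} → Vector Carrier n
  0v _ = 0#

  _·_ : ∀ {n} → Matrix n → Vector Carrier n → Vector Carrier n
  (A · v) i = sum (λ j → A i j * v j)

  combination : ∀ {k n} → Vector Carrier k → (Fin k → Vector Carrier n) → Vector Carrier n
  combination a b i = sum (λ j → a j * b j i)

  record IsBasis {p n k} (W : Pred (Vector Carrier n) p)
                 (b : Fin k → Vector Carrier n) : Set (c Level.⊔ ℓ Level.⊔ p) where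
    field
      member      : ∀ j → W (b j)
      independent : ∀ a → combination a b ≋ 0v → a ≋ 0v
      spanning    : ∀ w → W w → ∃[ a ] w ≋ combination a b

  HasDimension : ∀ {p n} → Pred (Vector Carrier n) p → ℕ → Set (c Level.⊔ ℓ Level.⊔ p)
  HasDimension {n = n} W k = Σ (Fin k → Vector Carrier n) (IsBasis W)

  Eigenspace : ∀ {n} → Matrix n → Carrier → Pred (Vector Carrier n) ℓ
  Eigenspace A μ v = A · v ≋ λ i → μ * v i

  IsEigenvalue : ∀ {n} → Matrix n → Carrier → Set (c Level.⊔ ℓ)
  IsEigenvalue A μ = ∃[ v ] (¬ (v ≋ 0v) × Eigenspace A μ v)

  -- There are exactly k eigenvalues of A satisfying P, counted with
  -- multiplicity, the multiplicity of μ being the dimension of its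
  -- eigenspace (A is only ever a symmetric real matrix below, where this
  -- is also the algebraic multiplicity).
  record EigenvalueCount {p n} (A : Matrix n) (P : Pred Carrier p) (k : ℕ)
                         : Set (c Level.⊔ ℓ Level.⊔ p) where
    field
      number       : ℕ
      eigenvalue   : Fin number → Carrier
      multiplicity : Fin number → ℕ
      isEigenvalue : ∀ i → IsEigenvalue A (eigenvalue i)
      satisfies    : ∀ i → P (eigenvalue i)
      distinct     : ∀ i j → i ≢ j → ¬ (eigenvalue i ≈ eigenvalue j)
      complete     : ∀ ν → P ν → IsEigenvalue A ν → ∃[ i ] ν ≈ eigenvalue i
      dimension    : ∀ i → HasDimension (Eigenspace A (eigenvalue i)) (multiplicity i)
      total        : ℕ.sum (List.tabulate multiplicity) ≡ k

------------------------------------------------------------------------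
-- The real numbers, characterised up to isomorphism as a Cauchy-complete
-- Archimedean ordered field. Trichotomy is replaced by cotransitivity and
-- tightness, and inverses are required for elements apart from 0, so that
-- constructive (e.g. Bishop's) reals qualify too; classically this is the
-- usual notion.

record Reals : Set₁ where
  infix 4 _<_
  field
    commutativeRing : CommutativeRing 0ℓ 0ℓ
  open CommutativeRing commutativeRing public
  open RawMonoidDefs +-rawMonoid using () renaming (_×_ to _×#_)

  field
    _<_                  : Rel Carrier 0ℓ
    isStrictPartialOrder : IsStrictPartialOrder _≈_ _<_
    <-cotrans            : Cotransitive _<_
    <-tight              : ∀ {x y} → ¬ (x < y) → ¬ (y < x) → x ≈ y
    0<1                  : 0# < 1#
    +-monoˡ-<            : ∀ {x y} z → x < y → x + z < y + z
    *-pos                : ∀ {x y} → 0# < x → 0# < y → 0# < x * y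
    inverse              : ∀ {x} → x < 0# ⊎ 0# < x → ∃[ y ] x * y ≈ 1#
    archimedean          : ∀ x → ∃[ n ] x < n ×# 1#

  -- |x m - x n| < ε, with the symmetry in m and n replacing the absolute value
  Cauchy : (ℕ → Carrier) → Set
  Cauchy x = ∀ ε → 0# < ε → ∃[ N ] ∀ m n → N ℕ.≤ m → N ℕ.≤ n → x m - x n < ε

  _⟶_ : (ℕ → Carrier) → Carrier → Set
  x ⟶ l = ∀ ε → 0# < ε → ∃[ N ] ∀ n → N ℕ.≤ n → (x n - l < ε) × (l - x n < ε)

  field
    cauchy-complete : ∀ x → Cauchy x → ∃[ l ] x ⟶ l

------------------------------------------------------------------------
-- Finite simple graphs

record Graph : Set₁ where
  field
    order  : ℕ
    Adj    : Rel (Fin order) 0ℓ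
    adj?   : Decidable Adj
    symm   : Symmetric Adj
    irrefl : Irreflexive _≡_ Adj

  Vertex : Set
  Vertex = Fin order

  -- each edge is listed once, with its smaller endpoint first
  edges : List (Vertex × Vertex)
  edges = filter (λ (u , v) → (u Fin.<? v) ×-dec adj? u v)
                 (cartesianProduct (allFin order) (allFin order))

  size : ℕ
  size = length edges

  Edge : Set
  Edge = Fin size

  Incident : Vertex → Edge → Set
  Incident v e = v ≡ proj₁ (lookup edges e) ⊎ v ≡ proj₂ (lookup edges e)

  incident? : Decidable Incident
  incident? v e = (v Fin.≟ proj₁ (lookup edges e)) ⊎-dec (v Fin.≟ proj₂ (lookup edges e))

  degree : Vertex → ℕ
  degree v = length (filter (adj? v) (allFin order))

  maxDegree : ℕ
  maxDegree = foldr _⊔_ 0 (map degree (allFin order))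

  Connected : Set
  Connected = ∀ u v → Star Adj u v

  TriangleFree : Set
  TriangleFree = ∀ u v w → ¬ (Adj u v × Adj v w × Adj u w)

  -- the cycle rank of a connected graph
  cycleRank : ℤ
  cycleRank = + size ℤ.- + order ℤ.+ + 1

lineGraph : Graph → Graph
lineGraph G = record
  { order  = size
  ; Adj    = λ e f → e ≢ f × ∃[ v ] (Incident v e × Incident v f)
  ; adj?   = λ e f → ¬? (e Fin.≟ f) ×-dec Fin.any? (λ v → incident? v e ×-dec incident? v f)
  ; symm   = λ (e≢f , v , p , q) → (λ f≡e → e≢f (sym f≡e)) , v , q , p
  ; irrefl = λ e≡f (e≢f , _) → e≢f e≡f
  }
  where open Graph G

------------------------------------------------------------------------
-- Cycle bases

module _ (G : Graph) where
  open Graph G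
  open LinearAlgebra xor-∧-commutativeRing

  rotate : ∀ {A : Set} → List A → List A
  rotate []       = []
  rotate (x ∷ xs) = xs ∷ʳ x

  -- (v₀ , v₁) , (v₁ , v₂) , … , (vₖ₋₁ , v₀)
  closedSteps : List Vertex → List (Vertex × Vertex)
  closedSteps vs = zip vs (rotate vs)

  record Cycle : Set where
    field
      vertices : List Vertex
      long     : 3 ℕ.≤ length vertices
      unique   : Unique vertices
      steps    : All (λ (u , v) → Adj u v) (closedSteps vertices)

  open Cycle

  cycleLength : Cycle → ℕ
  cycleLength C = length (vertices C)

  -- Subsets of the edge set, as vectors over 𝔽₂.
  EdgeSet : Set
  EdgeSet = Vector Bool size

  edgeSet : Cycle → EdgeSet
  edgeSet C e = does (any? (λ (u , v) → ((u , v) ≟ lookup edges e) ⊎-dec ((v , u) ≟ lookup edges e))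
                           (closedSteps (vertices C)))
    where _≟_ = ≡-dec Fin._≟_ Fin._≟_

  -- The edge sets meeting every vertex in an even number of edges: the sum
  -- is taken in 𝔽₂.
  CycleSpace : Pred EdgeSet 0ℓ
  CycleSpace S = ∀ v → sum (λ e → if does (incident? v e) then S e else false) ≡ false

  IsCycleBasis : List Cycle → Set
  IsCycleBasis B = IsBasis CycleSpace (λ i → edgeSet (lookup B i))

  totalLength : List Cycle → ℕ
  totalLength B = ℕ.sum (map cycleLength B)

  IsMinimumCycleBasis : List Cycle → Set
  IsMinimumCycleBasis B =
    IsCycleBasis B × (∀ B′ → IsCycleBasis B′ → totalLength B ℕ.≤ totalLength B′)

  HasMinimumCycleBasisOfLengths : List ℕ → Set
  HasMinimumCycleBasisOfLengths ls = ∃[ B ] (IsMinimumCycleBasis B × map cycleLength B ≡ ls)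

------------------------------------------------------------------------
-- Inertia and signature

module Spectral (ℝ : Reals) where
  open Reals ℝ
  open LinearAlgebra commutativeRing

  adjacencyMatrix : (H : Graph) → Matrix (Graph.order H)
  adjacencyMatrix H i j = if does (Graph.adj? H i j) then 1# else 0#

  HasPositive HasZero HasNegative : Graph → ℕ → Set
  HasPositive H = EigenvalueCount (adjacencyMatrix H) (0# <_)
  HasZero     H = EigenvalueCount (adjacencyMatrix H) (_≈ 0#)
  HasNegative H = EigenvalueCount (adjacencyMatrix H) (_< 0#)

  -- In(H) = (p , z , q)
  HasInertia : Graph → ℕ × ℕ × ℕ → Set
  HasInertia H (p , z , q) = HasPositive H p × HasZero H z × HasNegative H q

  HasSignature : Graph → ℤ → Set
  HasSignature H s = ∃[ p ] ∃[ q ] (HasPositive H p × HasNegative H q × s ≡ p ⊖ q)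

------------------------------------------------------------------------
-- The graph G₄₈

fromEdgeList : (n : ℕ) (es : List (ℕ × ℕ)) → All (λ (a , b) → a ≢ b) es → Graph
fromEdgeList n es loopless = record
  { order  = n
  ; Adj    = λ u v → (toℕ u , toℕ v) ∈ es ⊎ (toℕ v , toℕ u) ∈ es
  ; adj?   = λ u v → ((toℕ u , toℕ v) ∈? es) ⊎-dec ((toℕ v , toℕ u) ∈? es)
  ; symm   = swap
  ; irrefl = λ { refl → [ (λ p → All.lookup loopless p refl) , (λ p → All.lookup loopless p refl) ]′ }
  }
  where open DecMembership (≡-dec ℕ._≟_ ℕ._≟_) using (_∈?_)

edges₄₈ : List (ℕ × ℕ)
edges₄₈ =
    (0 , 1) ∷ (0 , 2) ∷ (0 , 3) ∷ (1 , 5) ∷ (1 , 12)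
  ∷ (1 , 13) ∷ (2 , 12) ∷ (3 , 16) ∷ (3 , 24) ∷ (4 , 5)
  ∷ (4 , 6) ∷ (5 , 7) ∷ (5 , 8) ∷ (6 , 31) ∷ (7 , 25)
  ∷ (9 , 10) ∷ (9 , 11) ∷ (11 , 14) ∷ (11 , 15) ∷ (13 , 22)
  ∷ (13 , 28) ∷ (14 , 26) ∷ (15 , 27) ∷ (16 , 17) ∷ (17 , 29)
  ∷ (17 , 30) ∷ (18 , 19) ∷ (19 , 20) ∷ (20 , 31) ∷ (21 , 22)
  ∷ (21 , 23) ∷ (24 , 43) ∷ (25 , 26) ∷ (26 , 27) ∷ (28 , 32)
  ∷ (29 , 37) ∷ (30 , 38) ∷ (30 , 39) ∷ (32 , 46) ∷ (33 , 34)
  ∷ (33 , 35) ∷ (34 , 36) ∷ (36 , 43) ∷ (37 , 39) ∷ (38 , 40)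
  ∷ (38 , 41) ∷ (40 , 42) ∷ (41 , 44) ∷ (44 , 45) ∷ (46 , 47)
  ∷ []

G₄₈ : Graph
G₄₈ = fromEdgeList 48 edges₄₈ (toWitness {a? = all? (λ (a , b) → ¬? (a ℕ.≟ b)) edges₄₈} _)

{-# OPTIONS --safe #-}

-- Let A be the adjacency matrix of L(G₄₈). If p is an integer polynomial and
-- e an integer vector with p(A) e = 0, then w(x) = ((p(A) - p(x)) / (A - x)) e,
-- a polynomial in x with integer vectors as coefficients, satisfies
-- A w(x) = x w(x) at every root x of p; and w(x) never vanishes if there is an
-- integer functional f that kills all coefficients of w except the constant
-- one. For e a suitable basis vector, p has degree 48, and its sign changes at
-- rational points locate 48 distinct real roots, 22 negative and 26 positive;
-- the eigenvalue -2 contributes two further integer eigenvectors. That these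
-- 50 orthogonal vectors span needs no determinants: if P is the orthogonal
-- projection onto their span, then I - P is a symmetric idempotent of trace 0,
-- hence 0.
--
-- The cycles of G₄₈ are one 4-cycle and two 5-cycles, pairwise disjoint, so
-- the cycles of any basis of the cycle space together traverse all 14 edges.

module Submission where

open import Defs
open import Algebra.Bundles using (CommutativeRing)
import Algebra.Properties.CommutativeMonoid.Sum
import Algebra.Properties.Ring
import Algebra.Properties.Semiring.Mult
import Algebra.Properties.Semiring.Sum
import Algebra.Solver.Ring
import Algebra.Solver.Ring.AlmostCommutativeRing as ACR
open import Data.Bool.Base using (Bool; true; false; if_then_else_; _∧_; _xor_)
import Data.Bool.Properties as Bool
open import Data.Empty using (⊥-elim)
open import Data.Fin using (#_)
open import Data.Fin.Base as Fin using (Fin; zero; suc; _↑ˡ_; _↑ʳ_)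
import Data.Fin.Properties as Fin
open import Data.Integer.Base as ℤ using (ℤ; +_; -[1+_]; _⊖_)
import Data.Integer.Properties as ℤ
open import Data.List.Base as List using (List; []; _∷_; length; lookup; map; concat; _++_)
import Data.List.Membership.DecPropositional as DecMembership
open import Data.List.Membership.Propositional using (_∈_; lose)
open import Data.List.Membership.Propositional.Properties
  using (∈-++⁺ˡ; ∈-++⁺ʳ; ∈-map⁺; ∈-lookup)
import Data.List.Properties as List
open import Data.List.Relation.Unary.All as All using (All; all?)
open import Data.List.Relation.Unary.Any as Any using (Any; any?)
import Data.List.Relation.Unary.Any.Properties as Any
open import Data.List.Relation.Unary.Unique.DecPropositional (Fin._≟_ {48}) using (unique?)
open import Data.Maybe.Base as Maybe using (Maybe)
open import Data.Nat.Base as ℕ using (ℕ; zero; suc)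
import Data.Nat.ListAction as ℕ
import Data.Nat.Properties as ℕ
open import Data.Product.Base using (∃-syntax; _×_; _,_; proj₁; proj₂; swap)
open import Data.Product.Properties using (≡-dec)
open import Data.Sum.Base as Sum using (_⊎_; inj₁; inj₂)
open import Data.Vec.Base as Vec using (Vec; []; _∷_)
open import Data.Vec.Functional using (Vector)
import Data.Vec.Properties as Vec
open import Function.Base using (_∘_; id)
open import Function.Bundles using (mk⇔)
open import Relation.Binary.Construct.Closure.ReflexiveTransitive as Star
  using (Star; _◅_; _◅◅_; reverse)
open import Relation.Binary.PropositionalEquality as ≡ using (_≡_; _≢_)
import Relation.Binary.Reasoning.Setoid
open import Relation.Binary.Structures using (IsStrictPartialOrder)
open import Relation.Nullary.Decidable using (does-⇔)
open import Relation.Nullary.Decidable.Core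
  using (Dec; does; yes; no; _×-dec_; _⊎-dec_; _→-dec_; ¬?; toWitness; dec⇒maybe)
open import Relation.Nullary.Negation.Core using (¬_; contradiction)

-- Ordered fields

-- The reals are constructive: the sign of a real cannot be decided, and only elements apart from 0
-- are invertible. Hence signs are decided only at fractions, where an integer computation settles
-- them; eigenvalues are compared through disjoint rational intervals; and the absence of further
-- eigenvalues comes from cotransitivity and tightness instead of a case distinction. What depends
-- on the particular graph is a finite check on integers. One vector e yields one eigenvector per
-- root of p, so an eigenvalue of multiplicity two has to be supplied separately. There is one: with
-- B the 48 by 50 incidence matrix, A + 2 = Bᵀ B has a kernel of dimension at least 50 - 48 = 2. The
-- vector e is suitable when e, A e, ..., A⁴⁷ e are independent. Then f exists as well: the
-- coefficients of w are the vectors q(A) e for the nonempty proper tails q of p, which have the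
-- degrees 0 to 47, so they are independent and the values of f on them can be prescribed.

module IntegerCast {c ℓ} (R : CommutativeRing c ℓ) where
  open CommutativeRing R hiding (zero)
  open Algebra.Properties.Semiring.Mult semiring renaming (_×_ to _×#_)
  open Algebra.Properties.Ring ring
  open Relation.Binary.Reasoning.Setoid setoid

  ι : ℤ → Carrier
  ι (+ n)      = n ×# 1#
  ι (-[1+ n ]) = - (suc n ×# 1#)

  ι-⊖ : ∀ m n → ι (m ⊖ n) ≈ m ×# 1# - n ×# 1#
  ι-⊖ zero    zero    = sym (-‿inverseʳ 0#)
  ι-⊖ zero    (suc n) = sym (+-identityˡ _)
  ι-⊖ (suc m) zero    = sym (trans (+-congˡ -0#≈0#) (+-identityʳ _))
  ι-⊖ (suc m) (suc n) = begin
    ι (suc m ⊖ suc n)                       ≡⟨ ≡.cong ι (ℤ.[1+m]⊖[1+n]≡m⊖n m n) ⟩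
    ι (m ⊖ n)                               ≈⟨ ι-⊖ m n ⟩
    m ×# 1# - n ×# 1#                       ≈⟨ +-congʳ (+-identityʳ _) ⟨
    m ×# 1# + 0# - n ×# 1#                  ≈⟨ +-congʳ (+-congˡ (-‿inverseʳ 1#)) ⟨
    m ×# 1# + (1# - 1#) - n ×# 1#           ≈⟨ +-congʳ (+-assoc _ _ _) ⟨
    m ×# 1# + 1# - 1# - n ×# 1#             ≈⟨ +-assoc _ _ _ ⟩
    m ×# 1# + 1# + (- 1# - n ×# 1#)         ≈⟨ +-cong (+-comm _ _) (-‿+-comm _ _) ⟩
    suc m ×# 1# - suc n ×# 1#               ∎

  ι-+ : ∀ i j → ι (i ℤ.+ j) ≈ ι i + ι j
  ι-+ (+ m)    (+ n)    = ×-homo-+ 1# m n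
  ι-+ (+ m)    -[1+ n ] = ι-⊖ m (suc n)
  ι-+ -[1+ m ] (+ n)    = trans (ι-⊖ n (suc m)) (+-comm _ _)
  ι-+ -[1+ m ] -[1+ n ] = begin
    - (suc (suc (m ℕ.+ n)) ×# 1#)           ≡⟨ ≡.cong (λ k → - (k ×# 1#)) (≡.cong suc (ℕ.+-suc m n)) ⟨
    - ((suc m ℕ.+ suc n) ×# 1#)             ≈⟨ -‿cong (×-homo-+ 1# (suc m) (suc n)) ⟩
    - (suc m ×# 1# + suc n ×# 1#)           ≈⟨ -‿+-comm _ _ ⟨
    - (suc m ×# 1#) - suc n ×# 1#           ∎

  ι-neg : ∀ i → ι (ℤ.- i) ≈ - ι i
  ι-neg (+ zero)  = sym -0#≈0#
  ι-neg (+ suc n) = refl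
  ι-neg -[1+ n ]  = sym (-‿involutive _)

  private
    ι-pos-* : ∀ m j → ι (+ m ℤ.* j) ≈ ι (+ m) * ι j
    ι-pos-* m (+ n) = begin
      ι (+ m ℤ.* + n)   ≡⟨ ≡.cong ι (ℤ.pos-* m n) ⟨
      (m ℕ.* n) ×# 1#    ≈⟨ ×1-homo-* m n ⟩
      m ×# 1# * n ×# 1#                     ∎
    ι-pos-* m -[1+ n ] = begin
      ι (+ m ℤ.* -[1+ n ])          ≡⟨ ≡.cong ι (ℤ.neg-distribʳ-* (+ m) (+ suc n)) ⟨
      ι (ℤ.- (+ m ℤ.* + suc n))     ≈⟨ ι-neg (+ m ℤ.* + suc n) ⟩
      - ι (+ m ℤ.* + suc n)         ≈⟨ -‿cong (ι-pos-* m (+ suc n)) ⟩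
      - (ι (+ m) * ι (+ suc n))     ≈⟨ -‿distribʳ-* _ _ ⟩
      ι (+ m) * ι -[1+ n ]          ∎

  ι-* : ∀ i j → ι (i ℤ.* j) ≈ ι i * ι j
  ι-* (+ m)    j = ι-pos-* m j
  ι-* -[1+ m ] j = begin
    ι (-[1+ m ] ℤ.* j)         ≡⟨ ≡.cong ι (ℤ.neg-distribˡ-* (+ suc m) j) ⟨
    ι (ℤ.- (+ suc m ℤ.* j))    ≈⟨ ι-neg (+ suc m ℤ.* j) ⟩
    - ι (+ suc m ℤ.* j)        ≈⟨ -‿cong (ι-pos-* (suc m) j) ⟩
    - (ι (+ suc m) * ι j)      ≈⟨ -‿distribˡ-* _ _ ⟩
    ι -[1+ m ] * ι j           ∎

  ι-1 : ι ℤ.1ℤ ≈ 1#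
  ι-1 = +-identityʳ 1#

  morphism : ℤ.+-*-rawRing ACR.-Raw-AlmostCommutative⟶ ACR.fromCommutativeRing R
  morphism = record
    { ⟦_⟧ = ι ; +-homo = ι-+ ; *-homo = ι-* ; -‿homo = ι-neg ; 0-homo = refl ; 1-homo = ι-1 }

  ≈-ι? : ∀ i j → Maybe (ι i ≈ ι j)
  ≈-ι? i j = Maybe.map (λ i≡j → reflexive (≡.cong ι i≡j)) (dec⇒maybe (i ℤ.≟ j))

  -- Equality in `R` is undecidable. With coefficients in ℤ, compared by decision, the normaliser
  -- can cancel terms and handle numerals.
  module Solver = Algebra.Solver.Ring ℤ.+-*-rawRing (ACR.fromCommutativeRing R) morphism ≈-ι?

module OrderedField (ℝ : Reals) where
  open Reals ℝ hiding (zero)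
  open IntegerCast commutativeRing
  open Solver using (solve; _:=_; _:+_; _:-_; _:*_; :-_; con)
  open IsStrictPartialOrder isStrictPartialOrder public
    using (<-respʳ-≈; <-respˡ-≈) renaming (irrefl to <-irrefl; trans to <-trans)
  open Algebra.Properties.Ring ring
  open Algebra.Properties.CommutativeMonoid.Sum +-commutativeMonoid using (sum)

  infix 4 _≤_ _#_

  -- Without trichotomy, "less or equal" as a disjunction would be too strong. The negation of the
  -- reverse strict order is still antisymmetric, by tightness.
  _≤_ _#_ : Carrier → Carrier → Set
  x ≤ y = ¬ (y < x)
  x # y = x < y ⊎ y < x

  -- Reduces one strict inequality to another by a ring identity between the differences, which the
  -- solver proves; this takes the place of linear arithmetic below.
  <-by-difference : ∀ {a b c d} → a < b → b - a ≈ d - c → c < d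
  <-by-difference {a} {b} {c} {d} a<b eq =
    <-respˡ-≈ (solve 2 (λ a c → a :+ (:- a :+ c) := c) refl a c)
      (<-respʳ-≈ b-a+c≈d (+-monoˡ-< (- a + c) a<b))
    where
    b-a+c≈d : b + (- a + c) ≈ d
    b-a+c≈d = trans (sym (+-assoc b (- a) c))
      (trans (+-congʳ eq) (solve 2 (λ d c → d :- c :+ c := d) refl d c))

  x<y⇒0<y-x : ∀ {x y} → x < y → 0# < y - x
  x<y⇒0<y-x {x} {y} x<y = <-by-difference x<y (solve 1 (λ z → z := z :- con (+ 0)) refl (y - x))

  0<y-x⇒x<y : ∀ {x y} → 0# < y - x → x < y
  0<y-x⇒x<y {x} {y} p = <-by-difference p (solve 1 (λ z → z :- con (+ 0) := z) refl (y - x))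

  neg-anti-< : ∀ {x y} → x < y → - y < - x
  neg-anti-< {x} {y} x<y = <-by-difference x<y (solve 2 (λ x y → y :- x := :- x :- :- y) refl x y)

  neg-pos : ∀ {x} → x < 0# → 0# < - x
  neg-pos x<0 = <-respˡ-≈ -0#≈0# (neg-anti-< x<0)

  <-asym : ∀ {x y} → x < y → ¬ (y < x)
  <-asym x<y y<x = <-irrefl refl (<-trans x<y y<x)

  +-mono-< : ∀ {a b c d} → a < b → c < d → a + c < b + d
  +-mono-< {a} {b} {c} {d} a<b c<d =
    <-trans (+-monoˡ-< c a<b) (<-respˡ-≈ (+-comm c b) (<-respʳ-≈ (+-comm d b) (+-monoˡ-< b c<d)))

  +-pos : ∀ {x y} → 0# < x → 0# < y → 0# < x + y
  +-pos 0<x 0<y = <-respˡ-≈ (+-identityˡ 0#) (+-mono-< 0<x 0<y)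

  -- Cotransitivity of `0# < x + y` at the point `x`; it finds a positive summand although signs are
  -- undecidable.
  +-pos⁻¹ : ∀ {x y} → 0# < x + y → 0# < x ⊎ 0# < y
  +-pos⁻¹ {x} {y} 0<x+y with <-cotrans 0<x+y x
  ... | inj₁ 0<x   = inj₁ 0<x
  ... | inj₂ x<x+y = inj₂ (<-by-difference x<x+y (solve 2 (λ x y → x :+ y :- x := y :- con (+ 0)) refl x y))

  <⇒≤ : ∀ {x y} → x < y → x ≤ y
  <⇒≤ = <-asym

  ≤-refl : ∀ {x} → x ≤ x
  ≤-refl = <-irrefl refl

  ≤-reflexive : ∀ {x y} → x ≈ y → x ≤ y
  ≤-reflexive x≈y = <-irrefl (sym x≈y)

  ≤-<-trans : ∀ {x y z} → x ≤ y → y < z → x < z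
  ≤-<-trans {x} x≤y y<z with <-cotrans y<z x
  ... | inj₁ y<x = contradiction y<x x≤y
  ... | inj₂ x<z = x<z

  <-≤-trans : ∀ {x y z} → x < y → y ≤ z → x < z
  <-≤-trans {z = z} x<y y≤z with <-cotrans x<y z
  ... | inj₁ x<z = x<z
  ... | inj₂ z<y = contradiction z<y y≤z

  ≤-trans : ∀ {x y z} → x ≤ y → y ≤ z → x ≤ z
  ≤-trans x≤y y≤z z<x = y≤z (<-≤-trans z<x x≤y)

  ≤-antisym : ∀ {x y} → x ≤ y → y ≤ x → x ≈ y
  ≤-antisym x≤y y≤x = <-tight y≤x x≤y

  +-nonneg : ∀ {x y} → 0# ≤ x → 0# ≤ y → 0# ≤ x + y
  +-nonneg 0≤x 0≤y x+y<0 with +-pos⁻¹ (<-respʳ-≈ (sym (-‿+-comm _ _)) (neg-pos x+y<0))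
  ... | inj₁ 0<-x = 0≤x (<-respˡ-≈ (-‿involutive _) (<-respʳ-≈ -0#≈0# (neg-anti-< 0<-x)))
  ... | inj₂ 0<-y = 0≤y (<-respˡ-≈ (-‿involutive _) (<-respʳ-≈ -0#≈0# (neg-anti-< 0<-y)))

  #⇒0<x² : ∀ {x} → x # 0# → 0# < x * x
  #⇒0<x² (inj₂ 0<x)     = *-pos 0<x 0<x
  #⇒0<x² {x} (inj₁ x<0) =
    <-respʳ-≈ (solve 1 (λ x → (:- x) :* (:- x) := x :* x) refl x) (*-pos (neg-pos x<0) (neg-pos x<0))

  -- No case distinction on the sign of `x` is available, but a negative square refutes both signs,
  -- so `x ≈ 0#` by tightness and the square is 0 after all.
  x²-nonneg : ∀ x → 0# ≤ x * x
  x²-nonneg x x²<0 = <-irrefl (trans (*-congʳ x≈0) (zeroˡ x)) x²<0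
    where
    x≈0 : x ≈ 0#
    x≈0 = <-tight (λ x<0 → <-asym x²<0 (#⇒0<x² (inj₁ x<0))) (λ 0<x → <-asym x²<0 (#⇒0<x² (inj₂ 0<x)))

  x²≈0⇒x≈0 : ∀ {x} → x * x ≈ 0# → x ≈ 0#
  x²≈0⇒x≈0 x²≈0 = <-tight (λ x<0 → <-irrefl (sym x²≈0) (#⇒0<x² (inj₁ x<0)))
                          (λ 0<x → <-irrefl (sym x²≈0) (#⇒0<x² (inj₂ 0<x)))

  -- If 0 < x < n and x z = 1, then n z < 1 would give n < x; hence 0 < n z.
  inverse-pos : ∀ {x} → 0# < x → ∃[ z ] 0# < z × x * z ≈ 1#
  inverse-pos {x} 0<x with inverse (inj₂ 0<x) | archimedean x
  ... | z , xz≈1 | n , x<n = z , 0<z , xz≈1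
    where
    multiple-pos : ∀ n → 0# < ι (+ n) * z → 0# < z
    multiple-pos zero    p = contradiction p (<-irrefl (sym (zeroˡ z)))
    multiple-pos (suc n) p with +-pos⁻¹ (<-respʳ-≈ (distribʳ z 1# _) p)
    ... | inj₁ q = <-respʳ-≈ (*-identityˡ z) q
    ... | inj₂ q = multiple-pos n q

    x[1-nz]≈x-n : ∀ t → x * (1# - t * z) - 0# ≈ x - t
    x[1-nz]≈x-n t = trans
      (solve 4 (λ x o t z → x :* (o :- t :* z) :- con (+ 0) := x :* o :- t :* (x :* z)) refl x 1# t z)
      (+-cong (*-identityʳ x) (-‿cong (trans (*-congˡ xz≈1) (*-identityʳ t))))

    0<z : 0# < z
    0<z with <-cotrans 0<1 (ι (+ n) * z)
    ... | inj₁ 0<nz = multiple-pos n 0<nz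
    ... | inj₂ nz<1 = contradiction
      (<-by-difference (*-pos 0<x (x<y⇒0<y-x nz<1)) (x[1-nz]≈x-n (ι (+ n)))) (<-asym x<n)

  *-pos-cancelˡ : ∀ {x y} → 0# < x → 0# < x * y → 0# < y
  *-pos-cancelˡ {x} {y} 0<x 0<xy with inverse-pos 0<x
  ... | z , 0<z , xz≈1 = <-respʳ-≈
    (trans (solve 3 (λ x y z → z :* (x :* y) := (x :* z) :* y)
         refl x y z) (trans (*-congʳ xz≈1) (*-identityˡ y)))
    (*-pos 0<z 0<xy)

  *-pos-cancelʳ : ∀ {x y} → 0# < y → 0# < x * y → 0# < x
  *-pos-cancelʳ 0<y 0<xy = *-pos-cancelˡ 0<y (<-respʳ-≈ (*-comm _ _) 0<xy)

  *-cancelˡ-0 : ∀ {x y} → x # 0# → x * y ≈ 0# → y ≈ 0#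
  *-cancelˡ-0 {x} {y} x#0 xy≈0 with inverse x#0
  ... | z , xz≈1 = begin
    y             ≈⟨ *-identityˡ y ⟨
    1# * y        ≈⟨ *-congʳ xz≈1 ⟨
    (x * z) * y   ≈⟨ solve 3 (λ x y z → (x :* z) :* y := z :* (x :* y)) refl x y z ⟩
    z * (x * y)   ≈⟨ *-congˡ xy≈0 ⟩
    z * 0#        ≈⟨ zeroʳ z ⟩
    0#            ∎
    where open Relation.Binary.Reasoning.Setoid setoid

  ι-pos : ∀ n → 0# < ι (+ suc n)
  ι-pos zero    = <-respʳ-≈ (sym (+-identityʳ 1#)) 0<1
  ι-pos (suc n) = +-pos 0<1 (ι-pos n)

  ι-mono-< : ∀ {i j} → i ℤ.< j → ι i < ι j
  ι-mono-< {i} {j} i<j = 0<y-x⇒x<y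
    (<-respʳ-≈ (trans (ι-+ j (ℤ.- i)) (+-congˡ (ι-neg i))) (0<ι 0<j-i))
    where
    0<j-i : ℤ.0ℤ ℤ.< j ℤ.- i
    0<j-i = ≡.subst (ℤ._< j ℤ.- i) (ℤ.+-inverseʳ i) (ℤ.+-monoˡ-< (ℤ.- i) i<j)
    0<ι : ∀ {k} → ℤ.0ℤ ℤ.< k → 0# < ι k
    0<ι {+ suc n} _ = ι-pos n
    0<ι {+ zero} (ℤ.+<+ ())

  ι-mono-≤ : ∀ {i j} → i ℤ.≤ j → ι i ≤ ι j
  ι-mono-≤ {i} {j} i≤j with i ℤ.≟ j
  ... | yes ≡.refl = ≤-refl
  ... | no  i≢j    = <⇒≤ (ι-mono-< (ℤ.≤∧≢⇒< i≤j i≢j))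

  sum-nonneg : ∀ {n} (f : Vector Carrier n) → (∀ i → 0# ≤ f i) → 0# ≤ sum f
  sum-nonneg {zero}  f 0≤f = ≤-refl
  sum-nonneg {suc n} f 0≤f = +-nonneg (0≤f zero) (sum-nonneg (λ i → f (suc i)) (λ i → 0≤f (suc i)))

  sum-pos : ∀ {n} (f : Vector Carrier n) → (∀ i → 0# ≤ f i) → ∀ i → 0# < f i → 0# < sum f
  sum-pos f 0≤f zero 0<f₀ = <-≤-trans 0<f₀ λ s<f₀ →
    sum-nonneg (λ i → f (suc i)) (λ i → 0≤f (suc i))
      (<-by-difference s<f₀ (solve 2 (λ a b → a :- (a :+ b) := con (+ 0) :- b) refl (f zero) _))
  sum-pos f 0≤f (suc i) 0<fᵢ = <-≤-trans (sum-pos (λ i → f (suc i)) (λ i → 0≤f (suc i)) i 0<fᵢ) λ s<r →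
    0≤f zero (<-by-difference s<r (solve 2 (λ a b → b :- (a :+ b) := con (+ 0) :- a) refl (f zero) _))

  sum≈0⇒≈0 : ∀ {n} (f : Vector Carrier n) → (∀ i → 0# ≤ f i) → sum f ≈ 0# → ∀ i → f i ≈ 0#
  sum≈0⇒≈0 f 0≤f s≈0 i = ≤-antisym (λ 0<fᵢ → <-irrefl (sym s≈0) (sum-pos f 0≤f i 0<fᵢ)) (0≤f i)

  _within_ : Carrier → Carrier → Set
  x within b = - b < x × x < b

  bounded : ∀ x → ∃[ b ] 0# < b × x within b
  bounded x with archimedean x | archimedean (- x)
  ... | m , x<m | n , -x<n = ι (+ suc (m ℕ.+ n)) , ι-pos (m ℕ.+ n)
      , (<-by-difference (<-≤-trans -x<n (ι-mono-≤ (ℤ.+≤+ (ℕ.m≤n⇒m≤1+n (ℕ.m≤n+m n m)))))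
          (solve 2 (λ x b → b :- :- x := x :- :- b) refl x _))
      , <-≤-trans x<m (ι-mono-≤ (ℤ.+≤+ (ℕ.m≤n⇒m≤1+n (ℕ.m≤m+n m n))))

-- Orthogonal eigenbases

module Sums {c ℓ} (R : CommutativeRing c ℓ) where
  open CommutativeRing R hiding (zero)
  open LinearAlgebra R
  open Algebra.Properties.Semiring.Sum semiring public
    using (sum-cong-≋; ∑-distrib-+; ∑-comm; *-distribˡ-sum; *-distribʳ-sum; sum-replicate; sum-replicate-zero)
  open Algebra.Properties.Semiring.Mult semiring using (×-homo-+) renaming (_×_ to _×#_)
  open Relation.Binary.Reasoning.Setoid setoid
  open IntegerCast R using (module Solver)
  open Solver using (solve; _:=_; _:*_)

  sum-single : ∀ {n} (f : Vector Carrier n) i → (∀ k → k ≢ i → f k ≈ 0#) → sum f ≈ f i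
  sum-single {suc n} f zero f≈0 = begin
    f zero + sum (f ∘ suc)                ≈⟨ +-congˡ (sum-cong-≋ (λ k → f≈0 (suc k) λ ())) ⟩
    f zero + sum {n} (λ _ → 0#)           ≈⟨ +-congˡ (sum-replicate-zero n) ⟩
    f zero + 0#                           ≈⟨ +-identityʳ _ ⟩
    f zero                                ∎
  sum-single {suc n} f (suc i) f≈0 = begin
    f zero + sum (f ∘ suc)
      ≈⟨ +-cong (f≈0 zero λ ()) (sum-single (f ∘ suc) i (λ k k≢i → f≈0 (suc k) (k≢i ∘ Fin.suc-injective))) ⟩
    0# + f (suc i)           ≈⟨ +-identityˡ _ ⟩
    f (suc i)                ∎

  sum-zero : ∀ {n} (f : Vector Carrier n) → (∀ k → f k ≈ 0#) → sum f ≈ 0#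
  sum-zero {n} f f≈0 = trans (sum-cong-≋ f≈0) (sum-replicate-zero n)

  dot : ∀ {n} → Vector Carrier n → Vector Carrier n → Carrier
  dot u v = sum (λ i → u i * v i)

  dot-cong : ∀ {n} {u u′ v v′ : Vector Carrier n} → u ≋ u′ → v ≋ v′ → dot u v ≈ dot u′ v′
  dot-cong u≋u′ v≋v′ = sum-cong-≋ (λ i → *-cong (u≋u′ i) (v≋v′ i))

  dot-comm : ∀ {n} (u v : Vector Carrier n) → dot u v ≈ dot v u
  dot-comm u v = sum-cong-≋ (λ i → *-comm (u i) (v i))

  dot-scaleʳ : ∀ {n} a (u v : Vector Carrier n) → dot u (λ i → a * v i) ≈ a * dot u v
  dot-scaleʳ a u v = trans
    (sum-cong-≋ (λ i → solve 3 (λ a u v → u :* (a :* v) := a :* (u :* v)) refl a (u i) (v i)))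
    (sym (*-distribˡ-sum a (λ i → u i * v i)))

  dot-scaleˡ : ∀ {n} a (u v : Vector Carrier n) → dot (λ i → a * u i) v ≈ a * dot u v
  dot-scaleˡ a u v = trans (dot-comm _ v) (trans (dot-scaleʳ a v u) (*-congˡ (dot-comm v u)))

  dot-sumʳ : ∀ {m n} (u : Vector Carrier n) (w : Fin m → Vector Carrier n) →
             dot u (λ i → sum (λ k → w k i)) ≈ sum (λ k → dot u (w k))
  dot-sumʳ {m} {n} u w = trans (sum-cong-≋ (λ i → *-distribˡ-sum (u i) (λ k → w k i))) (∑-comm (λ i k → u i * w k i))

  dot-combinationʳ : ∀ {m n} (u : Vector Carrier n) a (w : Fin m → Vector Carrier n) →
                     dot u (combination a w) ≈ sum (λ k → a k * dot u (w k))
  dot-combinationʳ u a w =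
    trans (dot-sumʳ u (λ k i → a k * w k i)) (sum-cong-≋ (λ k → dot-scaleʳ (a k) u (w k)))

  self-adjoint : ∀ {n} (A : Matrix n) → (∀ i j → A i j ≈ A j i) →
                 ∀ u v → dot (A · u) v ≈ dot u (A · v)
  self-adjoint {n} A A-sym u v = begin
    sum (λ i → sum (λ j → A i j * u j) * v i)
      ≈⟨ sum-cong-≋ (λ i → *-distribʳ-sum (v i) (λ j → A i j * u j)) ⟩
    sum (λ i → sum (λ j → A i j * u j * v i))     ≈⟨ ∑-comm (λ i j → A i j * u j * v i) ⟩
    sum (λ j → sum (λ i → A i j * u j * v i))     ≈⟨ sum-cong-≋ (λ j → sum-cong-≋ (λ i → entry i j)) ⟩
    sum (λ j → sum (λ i → u j * (A j i * v i)))
      ≈⟨ sum-cong-≋ (λ j → *-distribˡ-sum (u j) (λ i → A j i * v i)) ⟨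
    sum (λ j → u j * sum (λ i → A j i * v i))     ∎
    where
    entry : ∀ i j → A i j * u j * v i ≈ u j * (A j i * v i)
    entry i j = trans (*-congʳ (*-congʳ (A-sym i j)))
      (solve 3 (λ a u v → a :* u :* v := u :* (a :* v)) refl (A j i) (u j) (v i))

  indicator : ∀ {n} → Fin n → Vector Carrier n
  indicator i k = if does (i Fin.≟ k) then 1# else 0#

  indicator-≢ : ∀ {n} {i k : Fin n} → k ≢ i → indicator i k ≈ 0#
  indicator-≢ {i = i} {k} k≢i with i Fin.≟ k
  ... | yes i≡k = contradiction (≡.sym i≡k) k≢i
  ... | no  _   = refl

  indicator-refl : ∀ {n} (i : Fin n) → indicator i i ≈ 1#
  indicator-refl i with i Fin.≟ i
  ... | yes _   = refl
  ... | no  i≢i = contradiction ≡.refl i≢i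

  dot-indicator : ∀ {n} i (v : Vector Carrier n) → dot (indicator i) v ≈ v i
  dot-indicator i v = trans
    (sum-single _ i (λ k k≢i → trans (*-congʳ (indicator-≢ k≢i)) (zeroˡ (v k))))
    (trans (*-congʳ (indicator-refl i)) (*-identityˡ (v i)))

  sum-multiplicities : ∀ {g} (m : Fin g → ℕ) →
                       sum (λ i → sum {m i} (λ _ → 1#)) ≈ ℕ.sum (List.tabulate m) ×# 1#
  sum-multiplicities {zero}  m = refl
  sum-multiplicities {suc g} m = begin
    sum {m zero} (λ _ → 1#) + sum (λ i → sum {m (suc i)} (λ _ → 1#))
      ≈⟨ +-cong (sum-replicate (m zero)) (sum-multiplicities (m ∘ suc)) ⟩
    m zero ×# 1# + ℕ.sum (List.tabulate (m ∘ suc)) ×# 1#              ≈⟨ ×-homo-+ 1# (m zero) _ ⟨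
    (m zero ℕ.+ ℕ.sum (List.tabulate (m ∘ suc))) ×# 1#                ∎

module Diagonalisation (ℝ : Reals) where
  open Reals ℝ hiding (zero)
  open LinearAlgebra commutativeRing
  open OrderedField ℝ
  open Sums commutativeRing
  open IntegerCast commutativeRing using (module Solver)
  open Solver using (solve; _:=_; _:+_; _:*_; _:-_; con)
  open Algebra.Properties.Semiring.Mult semiring using () renaming (×-congˡ to ×#-congˡ; _×_ to _×#_)
  open Algebra.Properties.Ring ring using () renaming (x≈y⇒x∙y⁻¹≈ε to x≈y⇒x-y≈0; x∙y⁻¹≈ε⇒x≈y to x-y≈0⇒x≈y)
  open Relation.Binary.Reasoning.Setoid setoid

  dot-self-≈0 : ∀ {n} (u : Vector Carrier n) → u ≋ 0v → dot u u ≈ 0#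
  dot-self-≈0 u u≋0 = sum-zero (λ i → u i * u i) (λ i → trans (*-congʳ (u≋0 i)) (zeroˡ (u i)))

  -- Self-adjointness gives μ⟨u,v⟩ = ⟨Au,v⟩ = ⟨u,Av⟩ = ν⟨u,v⟩. Cancelling μ - ν takes apartness,
  -- since it must be inverted.
  eigenvectors-orthogonal : ∀ {n} {A : Matrix n} → (∀ i j → A i j ≈ A j i) → ∀ {μ ν} {u v : Vector Carrier n} →
    μ # ν → Eigenspace A μ u → Eigenspace A ν v → dot u v ≈ 0#
  eigenvectors-orthogonal {A = A} A-sym {μ} {ν} {u} {v} μ#ν Au≋μu Av≋νv = *-cancelˡ-0 μ-ν#0 (begin
    (μ - ν) * dot u v              ≈⟨ solve 3 (λ m n d → (m :- n) :* d := m :* d :- n :* d) refl μ ν (dot u v) ⟩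
    μ * dot u v - ν * dot u v      ≈⟨ x≈y⇒x-y≈0 μd≈νd ⟩
    0#                             ∎)
    where
    μ-ν#0 : μ - ν # 0#
    μ-ν#0 = Sum.map
      (λ μ<ν → <-by-difference μ<ν (solve 2 (λ m n → n :- m := con (+ 0) :- (m :- n)) refl μ ν))
      x<y⇒0<y-x μ#ν
    μd≈νd : μ * dot u v ≈ ν * dot u v
    μd≈νd = begin
      μ * dot u v              ≈⟨ dot-scaleˡ μ u v ⟨
      dot (λ i → μ * u i) v    ≈⟨ dot-cong Au≋μu (λ _ → refl) ⟨
      dot (A · u) v            ≈⟨ self-adjoint A A-sym u v ⟩
      dot u (A · v)            ≈⟨ dot-cong (λ _ → refl) Av≋νv ⟩
      dot u (λ i → ν * v i)    ≈⟨ dot-scaleʳ ν u v ⟩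
      ν * dot u v              ∎

  -- Which entry equals `ν`, if any, is undecidable. But of two entries apart from each other,
  -- cotransitivity rules out at least one, so a single candidate can be carried along the list.
  locate : ∀ {g} (λs : Fin (suc g) → Carrier) → (∀ i j → i ≢ j → λs i # λs j) →
           ∀ ν → ∃[ i ] (∀ j → j ≢ i → ν # λs j)
  locate {zero}  λs apart ν = zero , λ { zero j≢i → contradiction ≡.refl j≢i }
  locate {suc g} λs apart ν with locate (λs ∘ suc) (λ i j i≢j → apart (suc i) (suc j) (i≢j ∘ Fin.suc-injective)) ν
  ... | i , ν#others = Sum.[ use-suc , use-zero ] (cotrans# (apart zero (suc i) λ ()))
    where
    cotrans# : ∀ {x y} → x # y → ν # x ⊎ ν # y
    cotrans# (inj₁ x<y) = Sum.map inj₂ inj₁ (<-cotrans x<y ν)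
    cotrans# (inj₂ y<x) = Sum.swap (Sum.map inj₂ inj₁ (<-cotrans y<x ν))
    use-suc : ν # λs zero → ∃[ i ] (∀ j → j ≢ i → ν # λs j)
    use-suc ν#λ₀ = suc i , λ { zero _ → ν#λ₀ ; (suc j) j≢i → ν#others j (j≢i ∘ ≡.cong suc) }
    use-zero : ν # λs (suc i) → ∃[ i ] (∀ j → j ≢ i → ν # λs j)
    use-zero ν#λᵢ = zero , others
      where
      others : ∀ j → j ≢ zero → ν # λs j
      others zero    j≢0 = contradiction ≡.refl j≢0
      others (suc j) _   with j Fin.≟ i
      ... | yes ≡.refl = ν#λᵢ
      ... | no  j≢i    = ν#others j j≢i

  -- Grouped by eigenvalue to match `EigenvalueCount`, with at least one group so that `locate` has
  -- a candidate. Vectors are nonzero in the sense of a positive norm, which can be inverted;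
  -- `total` takes the place of spanning.
  record OrthogonalEigenbasis {n} (A : Matrix n) (g : ℕ) : Set where
    field
      eigenvalue   : Fin (suc g) → Carrier
      multiplicity : Fin (suc g) → ℕ
      vector       : ∀ a → Fin (multiplicity a) → Vector Carrier n
      eigenvector  : ∀ a j → Eigenspace A (eigenvalue a) (vector a j)
      apart        : ∀ a b → a ≢ b → eigenvalue a # eigenvalue b
      orthogonal   : ∀ a i j → i ≢ j → dot (vector a i) (vector a j) ≈ 0#
      nonzero      : ∀ a j → 0# < dot (vector a j) (vector a j)
      inhabited    : ∀ a → Fin (multiplicity a)
      total        : ℕ.sum (List.tabulate multiplicity) ≡ n

  module _ {n} {A : Matrix n} (A-sym : ∀ i j → A i j ≈ A j i) {g} (B : OrthogonalEigenbasis A g) where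
    open OrthogonalEigenbasis B

    private
      norm⁻¹ : ∀ a → Fin (multiplicity a) → Carrier
      norm⁻¹ a j = proj₁ (inverse (inj₂ (nonzero a j)))

      norm-inverse : ∀ a j → dot (vector a j) (vector a j) * norm⁻¹ a j ≈ 1#
      norm-inverse a j = proj₂ (inverse (inj₂ (nonzero a j)))

      ∑∑ : (∀ a → Fin (multiplicity a) → Carrier) → Carrier
      ∑∑ f = sum (λ a → sum (f a))

      ∑∑-cong : ∀ f f′ → (∀ a j → f a j ≈ f′ a j) → ∑∑ f ≈ ∑∑ f′
      ∑∑-cong f f′ f≈f′ = sum-cong-≋ (λ a → sum-cong-≋ (f≈f′ a))

      ∑∑-comm : ∀ {m} (f : ∀ a → Fin (multiplicity a) → Vector Carrier m) →
                sum (λ k → ∑∑ (λ a j → f a j k)) ≈ ∑∑ (λ a j → sum (f a j))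
      ∑∑-comm {m} f = trans (∑-comm (λ k a → sum (λ j → f a j k))) (sum-cong-≋ (λ a → ∑-comm (λ k j → f a j k)))

      *-distribʳ-∑∑ : ∀ f x → ∑∑ f * x ≈ ∑∑ (λ a j → f a j * x)
      *-distribʳ-∑∑ f x = trans (*-distribʳ-sum x (λ a → sum (f a))) (sum-cong-≋ (λ a → *-distribʳ-sum x (f a)))

      dot-∑∑ʳ : ∀ u (f : ∀ a → Fin (multiplicity a) → Carrier) →
                dot u (λ i → ∑∑ (λ a j → f a j * vector a j i)) ≈ ∑∑ (λ a j → f a j * dot u (vector a j))
      dot-∑∑ʳ u f = trans (dot-sumʳ u (λ a → combination (f a) (vector a)))
                          (sum-cong-≋ (λ a → dot-combinationʳ u (f a) (vector a)))

      all-orthogonal : ∀ a b i j → a ≢ b → dot (vector a i) (vector b j) ≈ 0#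
      all-orthogonal a b i j a≢b = eigenvectors-orthogonal A-sym (apart a b a≢b) (eigenvector a i) (eigenvector b j)

      -- Row `i` of the matrix P, the sum of v vᵀ / ⟨v, v⟩ over the eigenvectors v.
      projection : Fin n → Vector Carrier n
      projection i k = ∑∑ (λ a j → norm⁻¹ a j * vector a j i * vector a j k)

      dot-projection : ∀ i a j → dot (vector a j) (projection i) ≈ vector a j i
      dot-projection i a j = begin
        dot (vector a j) (projection i)
          ≈⟨ dot-∑∑ʳ (vector a j) (λ b k → norm⁻¹ b k * vector b k i) ⟩
        ∑∑ term
          ≈⟨ sum-single (λ b → sum (term b)) a (λ b b≢a → sum-zero (term b) (λ k →
               vanish (all-orthogonal a b j k (b≢a ∘ ≡.sym)))) ⟩
        sum (term a)
          ≈⟨ sum-single (term a) j (λ k k≢j → vanish (orthogonal a j k (k≢j ∘ ≡.sym))) ⟩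
        norm⁻¹ a j * vector a j i * dot (vector a j) (vector a j)
          ≈⟨ solve 3 (λ r v d → r :* v :* d := (d :* r) :* v) refl
               (norm⁻¹ a j) (vector a j i) (dot (vector a j) (vector a j)) ⟩
        dot (vector a j) (vector a j) * norm⁻¹ a j * vector a j i
          ≈⟨ *-congʳ (norm-inverse a j) ⟩
        1# * vector a j i
          ≈⟨ *-identityˡ _ ⟩
        vector a j i ∎
        where
        term : ∀ b → Fin (multiplicity b) → Carrier
        term b k = norm⁻¹ b k * vector b k i * dot (vector a j) (vector b k)
        vanish : ∀ {x y} → y ≈ 0# → x * y ≈ 0#
        vanish {x} y≈0 = trans (*-congˡ y≈0) (zeroʳ x)

      projection-idempotent : ∀ i → dot (projection i) (projection i) ≈ projection i i
      projection-idempotent i = trans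
        (dot-∑∑ʳ (projection i) (λ a j → norm⁻¹ a j * vector a j i))
        (∑∑-cong (λ a j → norm⁻¹ a j * vector a j i * dot (projection i) (vector a j))
                 (λ a j → norm⁻¹ a j * vector a j i * vector a j i)
                 (λ a j → *-congˡ (trans (dot-comm (projection i) (vector a j)) (dot-projection i a j))))

      -- Each v vᵀ / ⟨v, v⟩ has trace 1, and by `total` there are `n` of them.
      projection-trace : sum (λ i → projection i i) ≈ n ×# 1#
      projection-trace = begin
        sum (λ i → projection i i)              ≈⟨ ∑∑-comm term ⟩
        ∑∑ (λ a j → sum (term a j))             ≈⟨ ∑∑-cong (λ a j → sum (term a j)) (λ a j → 1#) normalised ⟩
        ∑∑ (λ a j → 1#)                         ≈⟨ sum-multiplicities multiplicity ⟩
        ℕ.sum (List.tabulate multiplicity) ×# 1#  ≈⟨ ×#-congˡ total ⟩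
        n ×# 1#                                 ∎
        where
        term : ∀ a → Fin (multiplicity a) → Vector Carrier n
        term a j i = norm⁻¹ a j * vector a j i * vector a j i
        normalised : ∀ a j → sum (term a j) ≈ 1#
        normalised a j = begin
          sum (term a j)
            ≈⟨ sum-cong-≋ (λ i → *-assoc (norm⁻¹ a j) (vector a j i) (vector a j i)) ⟩
          sum (λ i → norm⁻¹ a j * (vector a j i * vector a j i))
            ≈⟨ *-distribˡ-sum (norm⁻¹ a j) (λ i → vector a j i * vector a j i) ⟨
          norm⁻¹ a j * dot (vector a j) (vector a j)
            ≈⟨ *-comm _ _ ⟩
          dot (vector a j) (vector a j) * norm⁻¹ a j
            ≈⟨ norm-inverse a j ⟩
          1# ∎

      -- Row i of I - P has squared norm 1 - P i i, since P² = P, and these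
      -- numbers sum to n - tr P = 0.
      projection-identity : ∀ i k → projection i k ≈ indicator i k
      projection-identity i k = sym (x-y≈0⇒x≈y _ _ (x²≈0⇒x≈0
        (sum≈0⇒≈0 (λ k → complement i k * complement i k) (λ k → x²-nonneg (complement i k)) (complement≈0 i) k)))
        where
        complement : Fin n → Vector Carrier n
        complement i k = indicator i k - projection i k

        norm-complement : ∀ i → dot (complement i) (complement i) ≈ 1# - projection i i
        norm-complement i = begin
          dot (complement i) (complement i)
            ≈⟨ sum-cong-≋ (λ k → solve 2
                 (λ e p → (e :- p) :* (e :- p) := e :* (e :+ con (ℤ.- (+ 2)) :* p) :+ p :* p)
                 refl (indicator i k) (projection i k)) ⟩
          sum (λ k → indicator i k * (indicator i k + minus2 * projection i k) + projection i k * projection i k)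
            ≈⟨ ∑-distrib-+ (λ k → indicator i k * (indicator i k + minus2 * projection i k))
                           (λ k → projection i k * projection i k) ⟩
          dot (indicator i) (λ k → indicator i k + minus2 * projection i k) + dot (projection i) (projection i)
            ≈⟨ +-cong (dot-indicator i _) (projection-idempotent i) ⟩
          indicator i i + minus2 * projection i i + projection i i
            ≈⟨ +-congʳ (+-congʳ (indicator-refl i)) ⟩
          1# + minus2 * projection i i + projection i i
            ≈⟨ solve 2 (λ e p → e :+ con (ℤ.- (+ 2)) :* p :+ p := e :- p) refl 1# (projection i i) ⟩
          1# - projection i i ∎
          where
          minus2 : Carrier
          minus2 = IntegerCast.ι commutativeRing (ℤ.- (+ 2))

        trace-complement : sum (λ i → dot (complement i) (complement i)) ≈ 0#
        trace-complement = begin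
          sum (λ i → dot (complement i) (complement i))
            ≈⟨ cancel ⟨
          sum (λ i → dot (complement i) (complement i)) + sum (λ i → projection i i) - sum (λ i → projection i i)
            ≈⟨ +-congʳ (∑-distrib-+ (λ i → dot (complement i) (complement i)) (λ i → projection i i)) ⟨
          sum (λ i → dot (complement i) (complement i) + projection i i) - sum (λ i → projection i i)
            ≈⟨ +-cong (sum-cong-≋ (λ i → trans (+-congʳ (norm-complement i)) (restore i))) (-‿cong projection-trace) ⟩
          sum {n} (λ i → 1#) - n ×# 1#
            ≈⟨ x≈y⇒x-y≈0 (sum-replicate n) ⟩
          0# ∎
          where
          cancel : ∀ {x y} → x + y - y ≈ x
          cancel {x} {y} = solve 2 (λ x y → x :+ y :- y := x) refl x y
          restore : ∀ i → 1# - projection i i + projection i i ≈ 1#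
          restore i = solve 2 (λ x y → x :- y :+ y := x) refl 1# (projection i i)

        complement≈0 : ∀ i → dot (complement i) (complement i) ≈ 0#
        complement≈0 = sum≈0⇒≈0 (λ i → dot (complement i) (complement i))
          (λ i → sum-nonneg (λ k → complement i k * complement i k) (λ k → x²-nonneg (complement i k)))
          trace-complement

      coefficient : Vector Carrier n → ∀ a → Fin (multiplicity a) → Carrier
      coefficient w a j = norm⁻¹ a j * dot (vector a j) w

    -- This is w = I w = P w, written out along the eigenvectors.
    expansion : ∀ w → w ≋ λ i → sum (λ a → combination (coefficient w a) (vector a) i)
    expansion w i = begin
      w i
        ≈⟨ dot-indicator i w ⟨
      dot (indicator i) w
        ≈⟨ dot-cong (λ k → projection-identity i k) (λ _ → refl) ⟨
      dot (projection i) w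
        ≈⟨ sum-cong-≋ (λ k → *-distribʳ-∑∑ (λ a j → norm⁻¹ a j * vector a j i * vector a j k) (w k)) ⟩
      sum (λ k → ∑∑ (λ a j → term a j k))
        ≈⟨ ∑∑-comm term ⟩
      ∑∑ (λ a j → sum (term a j))
        ≈⟨ ∑∑-cong (λ a j → sum (term a j)) (λ a j → coefficient w a j * vector a j i) collect ⟩
      sum (λ a → combination (coefficient w a) (vector a) i) ∎
      where
      term : ∀ a → Fin (multiplicity a) → Vector Carrier n
      term a j k = norm⁻¹ a j * vector a j i * vector a j k * w k
      collect : ∀ a j → sum (term a j) ≈ coefficient w a j * vector a j i
      collect a j = begin
        sum (term a j)
          ≈⟨ sum-cong-≋ (λ k → *-assoc (norm⁻¹ a j * vector a j i) (vector a j k) (w k)) ⟩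
        sum (λ k → norm⁻¹ a j * vector a j i * (vector a j k * w k))
          ≈⟨ *-distribˡ-sum (norm⁻¹ a j * vector a j i) (λ k → vector a j k * w k) ⟨
        norm⁻¹ a j * vector a j i * dot (vector a j) w
          ≈⟨ solve 3 (λ r v d → r :* v :* d := r :* d :* v)
               refl (norm⁻¹ a j) (vector a j i) (dot (vector a j) w) ⟩
        coefficient w a j * vector a j i ∎

    private
      component-vanishes : ∀ w a → (∀ j → dot (vector a j) w ≈ 0#) → combination (coefficient w a) (vector a) ≋ 0v
      component-vanishes w a orth i =
        sum-zero (λ j → coefficient w a j * vector a j i) (λ j →
          trans (*-congʳ (trans (*-congˡ (orth j)) (zeroʳ (norm⁻¹ a j)))) (zeroˡ (vector a j i)))

    -- A vector of one eigenspace is orthogonal to all the others, so only one group survives in its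
    -- expansion.
    eigenspace-basis : ∀ a → IsBasis (Eigenspace A (eigenvalue a)) (vector a)
    eigenspace-basis a = record
      { member      = eigenvector a
      ; independent = λ c c·v≋0 j → *-cancelˡ-0 (inj₂ (nonzero a j)) (begin
          dot (vector a j) (vector a j) * c j
            ≈⟨ *-comm _ _ ⟩
          c j * dot (vector a j) (vector a j)
            ≈⟨ sum-single (λ k → c k * dot (vector a j) (vector a k)) j (λ k k≢j →
                 trans (*-congˡ (orthogonal a j k (k≢j ∘ ≡.sym))) (zeroʳ _)) ⟨
          sum (λ k → c k * dot (vector a j) (vector a k))
            ≈⟨ dot-combinationʳ (vector a j) c (vector a) ⟨
          dot (vector a j) (combination c (vector a))
            ≈⟨ sum-zero (λ i → vector a j i * combination c (vector a) i) (λ i →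
                 trans (*-congˡ (c·v≋0 i)) (zeroʳ _)) ⟩
          0# ∎)
      ; spanning    = λ w Aw≋λw → coefficient w a , λ i → trans (expansion w i)
          (sum-single (λ b → combination (coefficient w b) (vector b) i) a (λ b b≢a → component-vanishes w b
            (λ j → eigenvectors-orthogonal A-sym (apart b a b≢a) (eigenvector b j) Aw≋λw) i))
      }

    -- `locate` leaves one eigenvalue not known to be apart from `ν`. Were that one apart too, `w`
    -- would be orthogonal to the whole basis, hence zero by its expansion. Tightness turns the
    -- refuted apartness into equality.
    eigenvalues-exhaustive : ∀ {ν} → IsEigenvalue A ν → ∃[ a ] ν ≈ eigenvalue a
    eigenvalues-exhaustive {ν} (w , w≢0 , Aw≋νw) with locate eigenvalue apart ν
    ... | a , ν#others = a , <-tight (λ ν<λ → not-apart (inj₂ ν<λ)) (λ λ<ν → not-apart (inj₁ λ<ν))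
      where
      not-apart : ¬ (eigenvalue a # ν)
      not-apart λ#ν = w≢0 λ i → trans (expansion w i)
        (sum-zero (λ b → combination (coefficient w b) (vector b) i) (λ b → component-vanishes w b (λ j →
        eigenvectors-orthogonal A-sym (all-apart b) (eigenvector b j) Aw≋νw) i))
        where
        all-apart : ∀ b → eigenvalue b # ν
        all-apart b with b Fin.≟ a
        ... | yes ≡.refl = λ#ν
        ... | no  b≢a    = Sum.swap (ν#others b b≢a)

    -- A property of reals cannot be decided in general, so the eigenvalues satisfying `P` are
    -- handed over as an enumeration `σ` instead of being filtered out.
    eigenvalue-count : ∀ {m} (P : Carrier → Set) → (∀ {x y} → x ≈ y → P x → P y) →
      (σ : Fin m → Fin (suc g)) → (∀ i j → i ≢ j → σ i ≢ σ j) →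
      (∀ i → P (eigenvalue (σ i))) → (∀ a → P (eigenvalue a) → ∃[ i ] a ≡ σ i) →
      EigenvalueCount A P (ℕ.sum (List.tabulate (multiplicity ∘ σ)))
    eigenvalue-count {m} P P-resp σ σ-inj σ-P σ-onto = record
      { number       = m
      ; eigenvalue   = eigenvalue ∘ σ
      ; multiplicity = multiplicity ∘ σ
      ; isEigenvalue = λ i → vector (σ i) (inhabited (σ i))
          , (λ v≋0 → <-irrefl (sym (dot-self-≈0 (vector (σ i) (inhabited (σ i))) v≋0))
              (nonzero (σ i) (inhabited (σ i))))
          , eigenvector (σ i) (inhabited (σ i))
      ; satisfies    = σ-P
      ; distinct     = λ i j i≢j λᵢ≈λⱼ →
          Sum.[ <-irrefl λᵢ≈λⱼ , <-irrefl (sym λᵢ≈λⱼ) ] (apart (σ i) (σ j) (σ-inj i j i≢j))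
      ; complete     = complete′
      ; dimension    = λ i → vector (σ i) , eigenspace-basis (σ i)
      ; total        = ≡.refl
      }
      where
      named : ∀ {ν a} → ν ≈ eigenvalue a → (∃[ i ] a ≡ σ i) → ∃[ i ] ν ≈ eigenvalue (σ i)
      named ν≈λₐ (i , ≡.refl) = i , ν≈λₐ

      complete′ : ∀ ν → P ν → IsEigenvalue A ν → ∃[ i ] ν ≈ eigenvalue (σ i)
      complete′ ν Pν eig =
        let a , ν≈λₐ = eigenvalues-exhaustive eig in named ν≈λₐ (σ-onto a (P-resp ν≈λₐ Pν))

-- Real roots of integer polynomials

-- d ^ length p times the value at n / d of the polynomial with coefficients p,
-- constant term first.
homogeneous : List ℤ → ℤ → ℤ → ℤ
homogeneous []      n d = ℤ.0ℤ
homogeneous (c ∷ p) n d = c ℤ.* (d ℤ.* d ℤ.^ length p) ℤ.+ n ℤ.* homogeneous p n d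

-- An upward change from n / d to (n + 1) / d; a downward one is an upward change of the negated
-- polynomial. The weak inequalities are exactly the invariant that bisection maintains.
SignChange : List ℤ → ℤ → ℤ → Set
SignChange p n d = homogeneous p n d ℤ.≤ ℤ.0ℤ × ℤ.0ℤ ℤ.≤ homogeneous p (ℤ.suc n) d

module Roots (ℝ : Reals) where
  open Reals ℝ hiding (zero)
  open OrderedField ℝ
  open IntegerCast commutativeRing
  open Solver using (solve; _:=_; _:+_; _:*_; _:-_; :-_; con)
  open Algebra.Properties.Ring ring using (-0#≈0#)
  open Relation.Binary.Reasoning.Setoid setoid

  eval : List ℤ → Carrier → Carrier
  eval []      x = 0#
  eval (c ∷ p) x = ι c + x * eval p x

  eval-neg : ∀ p x → eval (List.map ℤ.-_ p) x ≈ - eval p x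
  eval-neg []      x = sym -0#≈0#
  eval-neg (c ∷ p) x = trans (+-cong (ι-neg c) (*-congˡ (eval-neg p x)))
    (solve 3 (λ c x e → :- c :+ x :* :- e := :- (c :+ x :* e)) refl (ι c) x (eval p x))

  within-≈ : ∀ {x y b} → x ≈ y → x within b → y within b
  within-≈ x≈y (-b<x , x<b) = <-respʳ-≈ x≈y -b<x , <-respˡ-≈ x≈y x<b

  within-≈ʳ : ∀ {x b c} → b ≈ c → x within b → x within c
  within-≈ʳ b≈c (-b<x , x<b) = <-respˡ-≈ (-‿cong b≈c) -b<x , <-respʳ-≈ b≈c x<b

  0-within : ∀ {b} → 0# < b → 0# within b
  0-within 0<b = <-respʳ-≈ -0#≈0# (neg-anti-< 0<b) , 0<b

  +-within : ∀ {x y a b} → x within a → y within b → (x + y) within (a + b)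
  +-within {a = a} {b} (-a<x , x<a) (-b<y , y<b) =
    <-respˡ-≈ (solve 2 (λ a b → :- a :+ :- b := :- (a :+ b)) refl a b) (+-mono-< -a<x -b<y) , +-mono-< x<a y<b

  within⇒pos : ∀ {x b} → x within b → 0# < b
  within⇒pos {x} {b} (-b<x , x<b) = *-pos-cancelˡ (ι-pos 1)
    (<-respʳ-≈ (solve 1 (λ b → b :- :- b := con (+ 2) :* b) refl b) (x<y⇒0<y-x (<-trans -b<x x<b)))

  -- The products (a - x)(b - y) and (a + x)(b + y) are positive and add up to 2(ab + xy); the two
  -- mixed products add up to 2(ab - xy). No signs of `x` and `y` enter.
  *-within : ∀ {x y a b} → x within a → y within b → (x * y) within (a * b)
  *-within {x} {y} {a} {b} (-a<x , x<a) (-b<y , y<b) =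
      <-by-difference (half (+-pos (*-pos (x<y⇒0<y-x x<a) (x<y⇒0<y-x y<b)) (*-pos (x<y⇒0<y-x -a<x) (x<y⇒0<y-x -b<y)))
        (solve 4 (λ x y a b → (a :- x) :* (b :- y) :+ (x :- :- a) :* (y :- :- b) := con (+ 2) :* (a :* b :+ x :* y))
             refl x y a b))
        (solve 4 (λ x y a b → a :* b :+ x :* y :- con (+ 0) := x :* y :- :- (a :* b)) refl x y a b)
    , <-by-difference (half (+-pos (*-pos (x<y⇒0<y-x x<a) (x<y⇒0<y-x -b<y)) (*-pos (x<y⇒0<y-x -a<x) (x<y⇒0<y-x y<b)))
        (solve 4 (λ x y a b → (a :- x) :* (y :- :- b) :+ (x :- :- a) :* (b :- y) := con (+ 2) :* (a :* b :- x :* y))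
             refl x y a b))
        (solve 4 (λ x y a b → a :* b :- x :* y :- con (+ 0) := a :* b :- x :* y) refl x y a b)
    where
    half : ∀ {s t} → 0# < s → s ≈ ι (+ 2) * t → 0# < t
    half 0<s s≈2t = *-pos-cancelˡ (ι-pos 1) (<-respʳ-≈ s≈2t 0<s)

  eval-bounded : ∀ p b → ∃[ m ] (∀ {x} → x within b → eval p x within m)
  eval-bounded []      b = 1# , λ _ → 0-within 0<1
  eval-bounded (c ∷ p) b =
    let k , _ , c<k = bounded (ι c)
        m , e<m = eval-bounded p b
    in k + b * m , λ x<b → +-within c<k (*-within x<b (e<m x<b))

  -- The product rule for differences, x e - y f = (x - y) e + y (e - f), along Horner's scheme. It
  -- provides the continuity used at the limit of the bisection.
  eval-lipschitz : ∀ p b → ∃[ m ] (∀ {x y δ} → x within b → y within b → (x - y) within δ →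
                                   (eval p x - eval p y) within (m * δ))
  eval-lipschitz [] b = 1# , λ _ _ d → within-≈ (sym (-‿inverseʳ 0#))
    (0-within (<-respʳ-≈ (sym (*-identityˡ _)) (within⇒pos d)))
  eval-lipschitz (c ∷ p) b =
    let k , e<k = eval-bounded p b
        m , lip = eval-lipschitz p b
    in k + b * m , λ {x} {y} {δ} x<b y<b d →
      within-≈ (solve 5 (λ c x y e f → (x :- y) :* e :+ y :* (e :- f) := c :+ x :* e :- (c :+ y :* f))
                 refl (ι c) x y (eval p x) (eval p y))
        (within-≈ʳ (solve 4 (λ d k b m → d :* k :+ b :* (m :* d) := (k :+ b :* m) :* d) refl δ k b m)
          (+-within (*-within d (e<k x<b)) (*-within y<b (lip x<b y<b d))))

  -- A real together with a fraction representing it. Bisection has to decide a sign at every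
  -- midpoint; here it is the sign of the integer `homogeneous p num den`.
  record Rational : Set where
    field
      value    : Carrier
      num den  : ℤ
      den-pos  : 0# < ι den
      fraction : value * ι den ≈ ι num

  open Rational

  ^-pos : ∀ d k → 0# < ι d → 0# < ι (d ℤ.^ k)
  ^-pos d zero    0<d = ι-pos 0
  ^-pos d (suc k) 0<d = <-respʳ-≈ (sym (ι-* d (d ℤ.^ k))) (*-pos 0<d (^-pos d k 0<d))

  eval-homogeneous : ∀ p {x} n d → x * ι d ≈ ι n → eval p x * ι (d ℤ.^ length p) ≈ ι (homogeneous p n d)
  eval-homogeneous []      n d xd≈n = zeroˡ _
  eval-homogeneous (c ∷ p) {x} n d xd≈n = begin
    (ι c + x * eval p x) * ι (d ℤ.* d ℤ.^ length p)
      ≈⟨ distribʳ _ _ _ ⟩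
    ι c * ι (d ℤ.* d ℤ.^ length p) + x * eval p x * ι (d ℤ.* d ℤ.^ length p)
      ≈⟨ +-cong (sym (ι-* c _)) (*-congˡ (ι-* d _)) ⟩
    ι (c ℤ.* (d ℤ.* d ℤ.^ length p)) + x * eval p x * (ι d * ι (d ℤ.^ length p))
      ≈⟨ +-congˡ (solve 4 (λ x e d p → x :* e :* (d :* p) := (x :* d) :* (e :* p))
           refl x (eval p x) (ι d) (ι (d ℤ.^ length p))) ⟩
    ι (c ℤ.* (d ℤ.* d ℤ.^ length p)) + (x * ι d) * (eval p x * ι (d ℤ.^ length p))
      ≈⟨ +-congˡ (trans (*-cong xd≈n (eval-homogeneous p n d xd≈n)) (sym (ι-* n _))) ⟩
    ι (c ℤ.* (d ℤ.* d ℤ.^ length p)) + ι (n ℤ.* homogeneous p n d)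
      ≈⟨ ι-+ (c ℤ.* (d ℤ.* d ℤ.^ length p)) (n ℤ.* homogeneous p n d) ⟨
    ι (homogeneous (c ∷ p) n d) ∎

  module _ (p : List ℤ) (x : Rational) where
    private
      h : ℤ
      h = homogeneous p (num x) (den x)

      scale : 0# < ι (den x ℤ.^ length p)
      scale = ^-pos (den x) (length p) (den-pos x)

      scaled : eval p (value x) * ι (den x ℤ.^ length p) ≈ ι h
      scaled = eval-homogeneous p (num x) (den x) (fraction x)

    eval-nonneg : ℤ.0ℤ ℤ.≤ h → 0# ≤ eval p (value x)
    eval-nonneg 0≤h e<0 = ι-mono-≤ 0≤h (<-by-difference (*-pos scale (neg-pos e<0))
      (trans (solve 2 (λ s e → s :* :- e :- con (+ 0) := con (+ 0) :- e :* s)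
           refl _ _) (+-congˡ (-‿cong scaled))))

    eval-nonpos : h ℤ.≤ ℤ.0ℤ → eval p (value x) ≤ 0#
    eval-nonpos h≤0 0<e = ι-mono-≤ h≤0 (<-respʳ-≈ (trans (*-comm _ _) scaled) (*-pos scale 0<e))

    sign? : eval p (value x) ≤ 0# ⊎ 0# ≤ eval p (value x)
    sign? = Sum.map eval-nonpos eval-nonneg (ℤ.≤-total h ℤ.0ℤ)

  private
    ½ : Carrier
    ½ = proj₁ (inverse-pos (ι-pos 1))

    2*½≈1 : ι (+ 2) * ½ ≈ 1#
    2*½≈1 = proj₂ (proj₂ (inverse-pos (ι-pos 1)))

    double : ∀ x → ι (+ 2) * (x * ½) ≈ x
    double x = trans (solve 3 (λ t x h → t :* (x :* h) := x :* (t :* h)) refl (ι (+ 2)) x ½)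
                     (trans (*-congˡ 2*½≈1) (*-identityʳ x))

  midpoint : Rational → Rational → Rational
  midpoint a b = record
    { value    = (value a + value b) * ½
    ; num      = num a ℤ.* den b ℤ.+ num b ℤ.* den a
    ; den      = + 2 ℤ.* (den a ℤ.* den b)
    ; den-pos  = <-respʳ-≈ (sym den≈) (*-pos (ι-pos 1) (*-pos (den-pos a) (den-pos b)))
    ; fraction = begin
        (value a + value b) * ½ * ι (+ 2 ℤ.* (den a ℤ.* den b))
          ≈⟨ *-congˡ den≈ ⟩
        (value a + value b) * ½ * (ι (+ 2) * (ι (den a) * ι (den b)))
          ≈⟨ solve 4 (λ t s d e → s :* (t :* (d :* e)) := (t :* s) :* (d :* e))
               refl (ι (+ 2)) ((value a + value b) * ½) (ι (den a)) (ι (den b)) ⟩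
        ι (+ 2) * ((value a + value b) * ½) * (ι (den a) * ι (den b))
          ≈⟨ *-congʳ (double (value a + value b)) ⟩
        (value a + value b) * (ι (den a) * ι (den b))
          ≈⟨ solve 4 (λ x y d e → (x :+ y) :* (d :* e) := (x :* d) :* e :+ (y :* e) :* d)
               refl (value a) (value b) (ι (den a)) (ι (den b)) ⟩
        value a * ι (den a) * ι (den b) + value b * ι (den b) * ι (den a)
          ≈⟨ +-cong (*-congʳ (fraction a)) (*-congʳ (fraction b)) ⟩
        ι (num a) * ι (den b) + ι (num b) * ι (den a)
          ≈⟨ +-cong (ι-* (num a) (den b)) (ι-* (num b) (den a)) ⟨
        ι (num a ℤ.* den b) + ι (num b ℤ.* den a)
          ≈⟨ ι-+ (num a ℤ.* den b) (num b ℤ.* den a) ⟨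
        ι (num a ℤ.* den b ℤ.+ num b ℤ.* den a) ∎
    }
    where
    den≈ : ι (+ 2 ℤ.* (den a ℤ.* den b)) ≈ ι (+ 2) * (ι (den a) * ι (den b))
    den≈ = trans (ι-* (+ 2) (den a ℤ.* den b)) (*-congˡ (ι-* (den a) (den b)))

  module _ (p : List ℤ) where

    record Bracket : Set where
      field
        lo hi    : Rational
        lo<hi    : value lo < value hi
        lo-below : eval p (value lo) ≤ 0#
        hi-above : 0# ≤ eval p (value hi)

      mid : Rational
      mid = midpoint lo hi

      width : Carrier
      width = value hi - value lo

      2[mid-lo]≈width : ι (+ 2) * (value mid - value lo) ≈ width
      2[mid-lo]≈width = trans (solve 2 (λ m a → con (+ 2) :* (m :- a) := con (+ 2) :* m :- con (+ 2) :* a)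
           refl (value mid) (value lo))
        (trans (+-congʳ (double (value lo + value hi)))
          (solve 2 (λ a b → a :+ b :- con (+ 2) :* a := b :- a) refl (value lo) (value hi)))

      2[hi-mid]≈width : ι (+ 2) * (value hi - value mid) ≈ width
      2[hi-mid]≈width = trans (solve 2 (λ m b → con (+ 2) :* (b :- m) := con (+ 2) :* b :- con (+ 2) :* m)
           refl (value mid) (value hi))
        (trans (+-congˡ (-‿cong (double (value lo + value hi))))
          (solve 2 (λ a b → con (+ 2) :* b :- (a :+ b) := b :- a) refl (value lo) (value hi)))

      lo<mid : value lo < value mid
      lo<mid = 0<y-x⇒x<y (*-pos-cancelˡ (ι-pos 1) (<-respʳ-≈ (sym 2[mid-lo]≈width) (x<y⇒0<y-x lo<hi)))

      mid<hi : value mid < value hi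
      mid<hi = 0<y-x⇒x<y (*-pos-cancelˡ (ι-pos 1) (<-respʳ-≈ (sym 2[hi-mid]≈width) (x<y⇒0<y-x lo<hi)))

    open Bracket

    halve : ∀ B → eval p (value (mid B)) ≤ 0# ⊎ 0# ≤ eval p (value (mid B)) → Bracket
    halve B (inj₁ below) = record
      { lo = mid B ; hi = hi B ; lo<hi = mid<hi B ; lo-below = below ; hi-above = hi-above B }
    halve B (inj₂ above) = record
      { lo = lo B ; hi = mid B ; lo<hi = lo<mid B ; lo-below = lo-below B ; hi-above = above }

    halve-lo : ∀ B s → value (lo B) ≤ value (lo (halve B s))
    halve-lo B (inj₁ _) = <⇒≤ (lo<mid B)
    halve-lo B (inj₂ _) = ≤-refl

    halve-hi : ∀ B s → value (hi (halve B s)) ≤ value (hi B)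
    halve-hi B (inj₁ _) = ≤-refl
    halve-hi B (inj₂ _) = <⇒≤ (mid<hi B)

    halve-width : ∀ B s → ι (+ 2) * width (halve B s) ≈ width B
    halve-width B (inj₁ _) = 2[hi-mid]≈width B
    halve-width B (inj₂ _) = 2[mid-lo]≈width B

    module Bisection (B : Bracket) where

      bisect : ℕ → Bracket
      bisect zero    = B
      bisect (suc n) = halve (bisect n) (sign? p (mid (bisect n)))

      a b : ℕ → Carrier
      a n = value (lo (bisect n))
      b n = value (hi (bisect n))

      a-mono : ∀ {m n} → m ℕ.≤′ n → a m ≤ a n
      a-mono ℕ.≤′-refl = ≤-refl
      a-mono (ℕ.≤′-step {n} m≤n) = ≤-trans (a-mono m≤n) (halve-lo (bisect n) (sign? p (mid (bisect n))))

      b-anti : ∀ {m n} → m ℕ.≤′ n → b n ≤ b m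
      b-anti ℕ.≤′-refl = ≤-refl
      b-anti (ℕ.≤′-step {n} m≤n) = ≤-trans (halve-hi (bisect n) (sign? p (mid (bisect n)))) (b-anti m≤n)

      bisect-width : ∀ n → ι (+ (2 ℕ.^ n)) * width (bisect n) ≈ width B
      bisect-width zero    = trans (*-congʳ ι-1) (*-identityˡ _)
      bisect-width (suc n) = begin
        ι (+ (2 ℕ.* 2 ℕ.^ n)) * w′
          ≈⟨ *-congʳ (trans (reflexive (≡.cong ι (ℤ.pos-* 2 (2 ℕ.^ n)))) (ι-* (+ 2) (+ (2 ℕ.^ n)))) ⟩
        ι (+ 2) * ι (+ (2 ℕ.^ n)) * w′
          ≈⟨ solve 3 (λ t k w → t :* k :* w := k :* (t :* w)) refl (ι (+ 2)) (ι (+ (2 ℕ.^ n))) w′ ⟩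
        ι (+ (2 ℕ.^ n)) * (ι (+ 2) * w′)     ≈⟨ *-congˡ (halve-width (bisect n) (sign? p (mid (bisect n)))) ⟩
        ι (+ (2 ℕ.^ n)) * width (bisect n)   ≈⟨ bisect-width n ⟩
        width B                              ∎
        where
        w′ : Carrier
        w′ = width (bisect (suc n))

      -- The width after n halvings is `width B` / 2ⁿ, and 2ⁿ > n exceeds `width B` / ε for n from
      -- the Archimedean property.
      shrinking : ∀ ε → 0# < ε → ∃[ n ] width (bisect n) < ε
      shrinking ε 0<ε =
        let z , 0<z , εz≈1 = inverse-pos 0<ε
            n , δz<n = archimedean (width B * z)
            δz<2ⁿ = <-≤-trans δz<n (ι-mono-≤ (ℤ.+≤+ (ℕ.<⇒≤ (n<2^n n))))
        in n , 0<y-x⇒x<y (*-pos-cancelˡ (<-≤-trans (ι-pos 0) (ι-mono-≤ (ℤ.+≤+ (ℕ.m^n>0 2 n))))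
             (<-respʳ-≈ (ε[2ⁿ-δz]≈2ⁿ[ε-w] n z εz≈1) (*-pos 0<ε (x<y⇒0<y-x δz<2ⁿ))))
        where
        n<2^n : ∀ n → n ℕ.< 2 ℕ.^ n
        n<2^n zero    = ℕ.≤-refl
        n<2^n (suc n) = ℕ.+-mono-≤ (ℕ.m^n>0 2 n) (≡.subst (suc n ℕ.≤_) (≡.sym (ℕ.+-identityʳ (2 ℕ.^ n))) (n<2^n n))
        ε[2ⁿ-δz]≈2ⁿ[ε-w] : ∀ n z → ε * z ≈ 1# →
          ε * (ι (+ (2 ℕ.^ n)) - width B * z) ≈ ι (+ (2 ℕ.^ n)) * (ε - width (bisect n))
        ε[2ⁿ-δz]≈2ⁿ[ε-w] n z εz≈1 = begin
          ε * (k - width B * z)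
            ≈⟨ solve 4 (λ e k d z → e :* (k :- d :* z) := k :* e :- d :* (e :* z)) refl ε k (width B) z ⟩
          k * ε - width B * (ε * z)
            ≈⟨ +-congˡ (-‿cong (trans (*-congˡ εz≈1) (trans (*-identityʳ _) (sym (bisect-width n))))) ⟩
          k * ε - k * width (bisect n)
            ≈⟨ solve 3 (λ k e w → k :* e :- k :* w := k :* (e :- w)) refl k ε (width (bisect n)) ⟩
          k * (ε - width (bisect n)) ∎
          where
          k : Carrier
          k = ι (+ (2 ℕ.^ n))

      a<b : ∀ n → a n < b n
      a<b n = lo<hi (bisect n)

      a-cauchy : Cauchy a
      a-cauchy ε 0<ε =
        let N , w<ε = shrinking ε 0<ε in N , λ m n N≤m N≤n →
          -- `a m` is at most `b N` and `a n` at least `a N`, so the difference is at most the width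
          -- of bracket `N`.
          ≤-<-trans (diff-≤ (≤-trans (<⇒≤ (a<b m)) (b-anti (ℕ.≤⇒≤′ N≤m))) (a-mono (ℕ.≤⇒≤′ N≤n))) w<ε
        where
        diff-≤ : ∀ {x y z w} → x ≤ y → w ≤ z → x - z ≤ y - w
        diff-≤ {x} {y} {z} {w} x≤y w≤z y-w<x-z =
          Sum.[ (λ 0<x-y → x≤y (0<y-x⇒x<y 0<x-y)) , (λ 0<w-z → w≤z (0<y-x⇒x<y 0<w-z)) ]
            (+-pos⁻¹ (<-respʳ-≈ (solve 4 (λ x y z w → x :- z :- (y :- w) := (x :- y) :+ (w :- z)) refl x y z w)
              (x<y⇒0<y-x y-w<x-z)))

      l : Carrier
      l = proj₁ (cauchy-complete a a-cauchy)

      a⟶l : a ⟶ l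
      a⟶l = proj₂ (cauchy-complete a a-cauchy)

      private
        later : ∀ m n → m ℕ.≤′ m ℕ.⊔ n × n ℕ.≤ m ℕ.⊔ n
        later m n = ℕ.≤⇒≤′ (ℕ.m≤m⊔n m n) , ℕ.m≤n⊔m m n

      a≤l : ∀ m → a m ≤ l
      a≤l m l<am =
        let N , close = a⟶l (a m - l) (x<y⇒0<y-x l<am)
            m≤n , N≤n = later m N
        in a-mono m≤n (<-by-difference (proj₁ (close _ N≤n))
             (solve 3 (λ c d l → d :- l :- (c :- l) := d :- c) refl (a (m ℕ.⊔ N)) (a m) l))

      l≤b : ∀ m → l ≤ b m
      l≤b m bm<l =
        let N , close = a⟶l (l - b m) (x<y⇒0<y-x bm<l)
            m≤n , N≤n = later m N
        in ≤-trans (<⇒≤ (a<b (m ℕ.⊔ N))) (b-anti m≤n) (<-by-difference (proj₂ (close _ N≤n))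
             (solve 3 (λ c d l → l :- d :- (l :- c) := c :- d) refl (a (m ℕ.⊔ N)) (b m) l))

      private
        r : Carrier
        r = proj₁ (bounded (a 0)) + proj₁ (bounded (b 0))

        between-within : ∀ {x} → a 0 ≤ x → x ≤ b 0 → x within r
        between-within {x} a≤x x≤b =
          let _ , 0<s , -s<a , _ = bounded (a 0)
              _ , 0<t , _ , b<t = bounded (b 0)
          in <-≤-trans (<-by-difference (+-mono-< -s<a 0<t)
               (solve 3 (λ a s t → a :+ t :- (:- s :+ con (+ 0)) := a :- :- (s :+ t)) refl (a 0) _ _)) a≤x
           , ≤-<-trans x≤b (<-by-difference (+-mono-< 0<s b<t)
               (solve 3 (λ b s t → s :+ t :- (con (+ 0) :+ b) := s :+ t :- b) refl (b 0) _ _))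

        l-within : l within r
        l-within = between-within (a≤l 0) (l≤b 0)

        m : Carrier
        m = proj₁ (eval-lipschitz p r)

        -- The Lipschitz constant `m` is replaced by a positive integer bound `M`, which can be
        -- inverted; a bracket narrower than ε / M then serves both of its ends.
        near : ∀ ε → 0# < ε → ∃[ n ] (eval p (a n) - eval p l) within ε × (eval p (b n) - eval p l) within ε
        near ε 0<ε =
          let M , 0<M , _ , m<M = bounded m
              z , 0<z , Mz≈1 = inverse-pos 0<M
              n , w<δ = shrinking (ε * z) (*-pos 0<ε 0<z)
              mδ<ε = <-respʳ-≈
                       (trans (solve 3 (λ M e z → M :* (e :* z) := e :* (M :* z))
                            refl M ε z) (trans (*-congˡ Mz≈1) (*-identityʳ ε)))
                       (0<y-x⇒x<y (<-respʳ-≈ (solve 3 (λ M m d → (M :- m) :* d := M :* d :- m :* d) refl M m (ε * z))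
                         (*-pos (x<y⇒0<y-x m<M) (*-pos 0<ε 0<z))))
              lip = λ {x} → proj₂ (eval-lipschitz p r) {x} {l} {ε * z}
              a≤b = λ k → <⇒≤ (a<b k)
              0≤n = ℕ.≤⇒≤′ (ℕ.z≤n {n})
          in n , weaken mδ<ε (lip (between-within (a-mono 0≤n) (≤-trans (a≤b n) (b-anti 0≤n))) l-within
                   (inside w<δ ≤-refl (a≤b n) (a≤l n) (l≤b n)))
               , weaken mδ<ε (lip (between-within (≤-trans (a-mono 0≤n) (a≤b n)) (b-anti 0≤n)) l-within
                   (inside w<δ (a≤b n) ≤-refl (a≤l n) (l≤b n)))
          where
          weaken : ∀ {x s t} → s < t → x within s → x within t
          weaken s<t (-s<x , x<s) = <-trans (neg-anti-< s<t) -s<x , <-trans x<s s<t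
          inside : ∀ {u v x y d} → v - u < d → u ≤ x → x ≤ v → u ≤ y → y ≤ v → (x - y) within d
          inside {u} {v} {x} {y} {d} v-u<d u≤x x≤v u≤y y≤v = lower , upper
            where
            bound : ∀ {s t} → s ≤ v → u ≤ t → s - t < d
            bound {s} {t} s≤v u≤t = ≤-<-trans (λ v-u<s-t →
              Sum.[ (λ q → s≤v (0<y-x⇒x<y q)) , (λ q → u≤t (0<y-x⇒x<y q)) ]
                (+-pos⁻¹ (<-respʳ-≈ (solve 4 (λ s t u v → s :- t :- (v :- u) := (s :- v) :+ (u :- t)) refl s t u v)
                  (x<y⇒0<y-x v-u<s-t)))) v-u<d
            upper : x - y < d
            upper = bound x≤v u≤y
            lower : - d < x - y
            lower = <-respʳ-≈ (solve 2 (λ x y → :- (y :- x) := x :- y) refl x y) (neg-anti-< (bound y≤v u≤x))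

      -- If the value at `l` were positive, taking it as ε would make the value at some left end
      -- positive, contrary to `lo-below`. A negative value is refuted at a right end.
      eval-l≈0 : eval p l ≈ 0#
      eval-l≈0 = ≤-antisym
        (λ 0<e → let n , (-e<d , _) , _ = near (eval p l) 0<e in
          lo-below (bisect n) (<-by-difference -e<d (solve 2 (λ x e → x :- e :- :- e := x :- con (+ 0)) refl _ _)))
        (λ e<0 → let n , _ , (_ , d<-e) = near (- eval p l) (neg-pos e<0) in
          hi-above (bisect n) (<-by-difference d<-e (solve 2 (λ x e → :- e :- (x :- e) := con (+ 0) :- x) refl _ _)))

    root : ∀ B → ∃[ l ] value (lo B) ≤ l × l ≤ value (hi B) × eval p l ≈ 0#
    root B = l , a≤l 0 , l≤b 0 , eval-l≈0
      where open Bisection B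

  ratio : ∀ n d → 0# < ι d → Rational
  ratio n d 0<d = record
    { value    = ι n * proj₁ d⁻¹
    ; num      = n
    ; den      = d
    ; den-pos  = 0<d
    ; fraction = trans (solve 3 (λ n z d → n :* z :* d := n :* (d :* z)) refl (ι n) (proj₁ d⁻¹) (ι d))
                       (trans (*-congˡ (proj₂ (proj₂ d⁻¹))) (*-identityʳ (ι n)))
    }
    where
    d⁻¹ : ∃[ z ] 0# < z × ι d * z ≈ 1#
    d⁻¹ = inverse-pos 0<d

  private
    root-of : ∀ p n d → 0# < ι d → SignChange p n d →
              ∃[ l ] ι n ≤ l * ι d × l * ι d ≤ ι (ℤ.suc n) × eval p l ≈ 0#
    root-of p n d 0<d (below , above) =
      let l , a≤l , l≤b , pl≈0 = root p record
            { lo = n/d ; hi = n+1/d ; lo<hi = lo<hi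
            ; lo-below = eval-nonpos p n/d below ; hi-above = eval-nonneg p n+1/d above }
      in l , scale-≤ (fraction n/d) refl a≤l , scale-≤ refl (fraction n+1/d) l≤b , pl≈0
      where
      n/d n+1/d : Rational
      n/d   = ratio n d 0<d
      n+1/d = ratio (ℤ.suc n) d 0<d
      scale-≤ : ∀ {x y u v} → x * ι d ≈ u → y * ι d ≈ v → x ≤ y → u ≤ v
      scale-≤ {x} {y} xd≈u yd≈v x≤y v<u = x≤y (0<y-x⇒x<y (*-pos-cancelʳ 0<d (<-respʳ-≈
        (trans (+-cong (sym xd≈u) (-‿cong (sym yd≈v)))
          (solve 3 (λ x y d → x :* d :- y :* d := (x :- y) :* d) refl x y (ι d)))
        (x<y⇒0<y-x v<u))))
      lo<hi : value n/d < value n+1/d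
      lo<hi = 0<y-x⇒x<y (*-pos-cancelʳ 0<d (<-respʳ-≈
        (trans (+-cong (sym (fraction n+1/d)) (-‿cong (sym (fraction n/d))))
          (solve 3 (λ x y d → x :* d :- y :* d := (x :- y) :* d) refl (value n+1/d) (value n/d) (ι d)))
        (x<y⇒0<y-x (ι-mono-< (ℤ.≤∧≢⇒< (ℤ.i≤suc[i] n) ℤ.i≢suc[i])))))

  -- The bounds are cleared of denominators, so that comparing two roots becomes comparing integers.
  root-between : ∀ p n d → 0# < ι d → SignChange p n d ⊎ SignChange (List.map ℤ.-_ p) n d →
                 ∃[ l ] ι n ≤ l * ι d × l * ι d ≤ ι (ℤ.suc n) × eval p l ≈ 0#
  root-between p n d 0<d (inj₁ change) = root-of p n d 0<d change
  root-between p n d 0<d (inj₂ change) =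
    let l , lower , upper , e≈0 = root-of (List.map ℤ.-_ p) n d 0<d change
    in l , lower , upper , trans (solve 1 (λ e → e := :- :- e) refl (eval p l))
         (trans (-‿cong (trans (sym (eval-neg p l)) e≈0)) -0#≈0#)

-- Eigenvectors of 0-1 matrices

-- The product with a 0-1 row by additions alone, which keeps the evaluation of the certificate
-- cheap.
select : ∀ {n} → Vec Bool n → Vec ℤ n → ℤ
select []           []       = ℤ.0ℤ
select (true  ∷ bs) (x ∷ xs) = x ℤ.+ select bs xs
select (false ∷ bs) (x ∷ xs) = select bs xs

_⊛_ : ∀ {m n} → Vec (Vec Bool n) m → Vec ℤ n → Vec ℤ m
M ⊛ v = Vec.map (λ row → select row v) M

inner : ∀ {n} → Vec ℤ n → Vec ℤ n → ℤ
inner []       []       = ℤ.0ℤ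
inner (x ∷ xs) (y ∷ ys) = x ℤ.* y ℤ.+ inner xs ys

does-true : ∀ {A : Set} (a? : Dec A) → does a? ≡ true → A
does-true (yes a) _ = a

-- For a polynomial p, the vector p(M) e together with the truth value of
-- the claim that f is orthogonal to q(M) e for every proper tail q of p.
-- Both are computed in one pass, so that the vectors are shared.
module Krylov {n} (M : Vec (Vec Bool n) n) (e f : Vec ℤ n) where

  krylov-step : ℤ → Vec ℤ n × Bool → Vec ℤ n × Bool
  krylov-step c r = Vec.zipWith ℤ._+_ (M ⊛ proj₁ r) (Vec.map (c ℤ.*_) e)
                  , proj₂ r ∧ does (inner f (proj₁ r) ℤ.≟ ℤ.0ℤ)

  krylov : List ℤ → Vec ℤ n × Bool
  krylov []      = Vec.replicate n ℤ.0ℤ , true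
  krylov (c ∷ p) = krylov-step c (krylov p)

  certificate-step : ℤ → ℤ → Vec ℤ n × Bool → Bool
  certificate-step d c r =
    proj₂ r ∧ (does (inner f (proj₁ r) ℤ.≟ d)
    ∧ does (Vec.≡-dec ℤ._≟_ (proj₁ (krylov-step c r)) (Vec.replicate n ℤ.0ℤ)))

  -- Concerns the polynomial c + x p(x): it annihilates `e`, and `f` takes the value `d` on the
  -- constant coefficient p(M) e of w and 0 on all the others.
  certificate : ℤ → ℤ → List ℤ → Bool
  certificate d c p = certificate-step d c (krylov p)

module IntegerMatrix (ℝ : Reals) where
  open Reals ℝ hiding (zero)
  open LinearAlgebra commutativeRing
  open OrderedField ℝ
  open Sums commutativeRing
  open IntegerCast commutativeRing
  open Solver using (solve; _:=_; _:+_; _:*_; _:-_; :-_; con)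
  open Roots ℝ using (eval)
  open Relation.Binary.Reasoning.Setoid setoid

  cast : ∀ {n} → Vec ℤ n → Vector Carrier n
  cast v i = ι (Vec.lookup v i)

  bit : Bool → Carrier
  bit b = if b then 1# else 0#

  select-cast : ∀ {n} (bs : Vec Bool n) xs →
                sum (λ j → bit (Vec.lookup bs j) * cast xs j) ≈ ι (select bs xs)
  select-cast []           []       = refl
  select-cast (true  ∷ bs) (x ∷ xs) =
    trans (+-cong (*-identityˡ (ι x)) (select-cast bs xs)) (sym (ι-+ x (select bs xs)))
  select-cast (false ∷ bs) (x ∷ xs) =
    trans (+-cong (zeroˡ (ι x)) (select-cast bs xs)) (+-identityˡ _)

  dot-cast : ∀ {n} (xs ys : Vec ℤ n) → dot (cast xs) (cast ys) ≈ ι (inner xs ys)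
  dot-cast []       []       = refl
  dot-cast (x ∷ xs) (y ∷ ys) =
    trans (+-cong (sym (ι-* x y)) (dot-cast xs ys)) (sym (ι-+ (x ℤ.* y) (inner xs ys)))

  ·-linear : ∀ {n} (A : Matrix n) x u v i →
             (A · (λ j → u j + x * v j)) i ≈ (A · u) i + x * (A · v) i
  ·-linear A x u v i = begin
    sum (λ j → A i j * (u j + x * v j))
      ≈⟨ sum-cong-≋ (λ j → solve 4 (λ a u x v → a :* (u :+ x :* v) := a :* u :+ x :* (a :* v))
           refl (A i j) (u j) x (v j)) ⟩
    sum (λ j → A i j * u j + x * (A i j * v j))
      ≈⟨ ∑-distrib-+ (λ j → A i j * u j) (λ j → x * (A i j * v j)) ⟩
    (A · u) i + sum (λ j → x * (A i j * v j))
      ≈⟨ +-congˡ (*-distribˡ-sum x (λ j → A i j * v j)) ⟨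
    (A · u) i + x * (A · v) i ∎

  dot-linear : ∀ {n} x (f u v : Vector Carrier n) →
               dot f (λ j → u j + x * v j) ≈ dot f u + x * dot f v
  dot-linear x f u v = begin
    sum (λ j → f j * (u j + x * v j))
      ≈⟨ sum-cong-≋ (λ j → solve 4 (λ a u x v → a :* (u :+ x :* v) := a :* u :+ x :* (a :* v))
           refl (f j) (u j) x (v j)) ⟩
    sum (λ j → f j * u j + x * (f j * v j))
      ≈⟨ ∑-distrib-+ (λ j → f j * u j) (λ j → x * (f j * v j)) ⟩
    dot f u + sum (λ j → x * (f j * v j))
      ≈⟨ +-congˡ (*-distribˡ-sum x (λ j → f j * v j)) ⟨
    dot f u + x * dot f v ∎

  -- One summand f i w i is positive; then (f i w i)² + (w i)² = ((f i)² + 1) (w i)² is as well.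
  dot-pos⇒nonzero : ∀ {n} (f w : Vector Carrier n) → 0# < dot f w → 0# < dot w w
  dot-pos⇒nonzero f w 0<fw with sum-pos⁻¹ (λ i → f i * w i) 0<fw
    where
    sum-pos⁻¹ : ∀ {n} (g : Vector Carrier n) → 0# < sum g → ∃[ i ] 0# < g i
    sum-pos⁻¹ {zero}  g 0<0 = contradiction 0<0 (<-irrefl refl)
    sum-pos⁻¹ {suc n} g 0<s with +-pos⁻¹ 0<s
    ... | inj₁ 0<g₀ = zero , 0<g₀
    ... | inj₂ 0<s′ with sum-pos⁻¹ (g ∘ suc) 0<s′
    ...   | i , 0<gᵢ = suc i , 0<gᵢ
  ... | i , 0<fwᵢ = sum-pos (λ i → w i * w i) (λ i → x²-nonneg (w i)) i
    (*-pos-cancelˡ (+-pos-nonneg (ι-pos 0) (x²-nonneg (f i)))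
      (<-respʳ-≈ (solve 2 (λ f w → (f :* w) :* (f :* w) :+ w :* w := (con (+ 1) :+ f :* f) :* (w :* w))
           refl (f i) (w i))
        (+-pos-nonneg (*-pos 0<fwᵢ 0<fwᵢ) (x²-nonneg (w i)))))
    where
    +-pos-nonneg : ∀ {x y} → 0# < x → 0# ≤ y → 0# < x + y
    +-pos-nonneg {x} {y} 0<x 0≤y = <-≤-trans 0<x λ x+y<x →
      0≤y (<-by-difference x+y<x (solve 2 (λ x y → x :- (x :+ y) := con (+ 0) :- y) refl x y))

  module _ {n} (adjacent : Fin n → Fin n → Bool) where

    table : Vec (Vec Bool n) n
    table = Vec.tabulate (λ i → Vec.tabulate (adjacent i))

    matrix : Matrix n
    matrix i j = bit (adjacent i j)

    ·-cast : ∀ v → matrix · cast v ≋ cast (table ⊛ v)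
    ·-cast v i = begin
      sum (λ j → bit (adjacent i j) * cast v j)
        ≈⟨ sum-cong-≋ (λ j → *-congʳ (reflexive (≡.cong bit (≡.sym (lookup-table j))))) ⟩
      sum (λ j → bit (Vec.lookup (Vec.lookup table i) j) * cast v j)
        ≈⟨ select-cast (Vec.lookup table i) v ⟩
      ι (select (Vec.lookup table i) v)
        ≡⟨ ≡.cong ι (Vec.lookup-map i (λ row → select row v) table) ⟨
      cast (table ⊛ v) i ∎
      where
      lookup-table : ∀ j → Vec.lookup (Vec.lookup table i) j ≡ adjacent i j
      lookup-table j = ≡.trans
        (≡.cong (λ row → Vec.lookup row j) (Vec.lookup∘tabulate (λ i → Vec.tabulate (adjacent i)) i))
        (Vec.lookup∘tabulate (adjacent i) j)

    integer-eigenvector : ∀ k v → table ⊛ v ≡ Vec.map (k ℤ.*_) v → Eigenspace matrix (ι k) (cast v)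
    integer-eigenvector k v Mv≡kv i = begin
      (matrix · cast v) i                  ≈⟨ ·-cast v i ⟩
      cast (table ⊛ v) i                   ≡⟨ ≡.cong (λ u → cast u i) Mv≡kv ⟩
      cast (Vec.map (k ℤ.*_) v) i          ≡⟨ ≡.cong ι (Vec.lookup-map i (k ℤ.*_) v) ⟩
      ι (k ℤ.* Vec.lookup v i)             ≈⟨ ι-* k (Vec.lookup v i) ⟩
      ι k * cast v i                       ∎

    module _ (e f : Vec ℤ n) where
      open Krylov table e f

      -- ((p(A) - p(x)) / (A - x)) e
      quotient : List ℤ → Carrier → Vector Carrier n
      quotient []      x i = 0#
      quotient (c ∷ p) x i = cast (proj₁ (krylov p)) i + x * quotient p x i

      cast-krylov : ∀ c p i → cast (proj₁ (krylov (c ∷ p))) i ≈ (matrix · cast (proj₁ (krylov p))) i + ι c * cast e i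
      cast-krylov c p i = begin
        cast (Vec.zipWith ℤ._+_ (table ⊛ v) (Vec.map (c ℤ.*_) e)) i
          ≡⟨ ≡.cong ι (Vec.lookup-zipWith ℤ._+_ i (table ⊛ v) (Vec.map (c ℤ.*_) e)) ⟩
        ι (Vec.lookup (table ⊛ v) i ℤ.+ Vec.lookup (Vec.map (c ℤ.*_) e) i)
          ≈⟨ ι-+ (Vec.lookup (table ⊛ v) i) _ ⟩
        cast (table ⊛ v) i + ι (Vec.lookup (Vec.map (c ℤ.*_) e) i)
          ≈⟨ +-cong (sym (·-cast v i)) (trans (reflexive (≡.cong ι (Vec.lookup-map i (c ℤ.*_) e))) (ι-* c (Vec.lookup e i))) ⟩
        (matrix · cast v) i + ι c * cast e i ∎
        where
        v : Vec ℤ n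
        v = proj₁ (krylov p)

      cast-zero : ∀ (v : Vec ℤ n) → v ≡ Vec.replicate n ℤ.0ℤ → cast v ≋ 0v
      cast-zero _ ≡.refl i = reflexive (≡.cong ι (Vec.lookup-replicate i ℤ.0ℤ))

      -- This is (A - x) w(x) = (p(A) - p(x)) e. It is stated at every `x`, since the tails met in
      -- the induction do not share the roots of the whole polynomial.
      ·-quotient : ∀ p x i → (matrix · quotient p x) i ≈
                   x * quotient p x i + (cast (proj₁ (krylov p)) i - eval p x * cast e i)
      ·-quotient [] x i = begin
        (matrix · quotient [] x) i  ≈⟨ sum-zero (λ j → matrix i j * 0#) (λ j → zeroʳ _) ⟩
        0#
          ≈⟨ solve 2 (λ x e → con (+ 0) := x :* con (+ 0) :+ (con (+ 0) :- con (+ 0) :* e)) refl x (cast e i) ⟩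
        x * 0# + (0# - 0# * cast e i)  ≈⟨ +-congˡ (+-congʳ (cast-zero (Vec.replicate n ℤ.0ℤ) ≡.refl i)) ⟨
        x * quotient [] x i + (cast (Vec.replicate n ℤ.0ℤ) i - 0# * cast e i) ∎
      ·-quotient (c ∷ p) x i = begin
        (matrix · quotient (c ∷ p) x) i
          ≈⟨ ·-linear matrix x (cast (proj₁ (krylov p))) (quotient p x) i ⟩
        Kp + x * (matrix · quotient p x) i
          ≈⟨ +-congˡ (*-congˡ (·-quotient p x i)) ⟩
        Kp + x * (x * quotient p x i + (b - eval p x * cast e i))
          ≈⟨ solve 7 (λ k x q b v e c → k :+ x :* (x :* q :+ (b :- v :* e)) := x :* (b :+ x :* q) :+ (k :+ c :* e :- (c :+ x :* v) :* e))
               refl Kp x (quotient p x i) b (eval p x) (cast e i) (ι c) ⟩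
        x * (b + x * quotient p x i) + (Kp + ι c * cast e i - (ι c + x * eval p x) * cast e i)
          ≈⟨ +-congˡ (+-congʳ (cast-krylov c p i)) ⟨
        x * quotient (c ∷ p) x i + (cast (proj₁ (krylov (c ∷ p))) i - eval (c ∷ p) x * cast e i) ∎
        where
        b Kp : Carrier
        b  = cast (proj₁ (krylov p)) i
        Kp = (matrix · cast (proj₁ (krylov p))) i

      -- The coefficients of the quotient are q(A) e for the proper tails q of `p`, which are the
      -- vectors tested by the flag.
      dot-quotient : ∀ p x → proj₂ (krylov p) ≡ true → dot (cast f) (quotient p x) ≈ 0#
      dot-quotient []      x _  = sum-zero (λ i → cast f i * 0#) (λ i → zeroʳ _)
      dot-quotient (c ∷ p) x ok = begin
        dot (cast f) (quotient (c ∷ p) x)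
          ≈⟨ dot-linear x (cast f) (cast (proj₁ (krylov p))) (quotient p x) ⟩
        dot (cast f) (cast (proj₁ (krylov p))) + x * dot (cast f) (quotient p x)
          ≈⟨ +-cong (dot-cast f (proj₁ (krylov p))) (*-congˡ (dot-quotient p x (Bool.∧-conicalˡ _ _ ok))) ⟩
        ι (inner f (proj₁ (krylov p))) + x * 0#
          ≈⟨ +-cong (reflexive (≡.cong ι (does-true (inner f (proj₁ (krylov p)) ℤ.≟ ℤ.0ℤ)
               (Bool.∧-conicalʳ (proj₂ (krylov p)) _ ok)))) (zeroʳ x) ⟩
        0# + 0#
          ≈⟨ +-identityˡ 0# ⟩
        0# ∎

      module _ d c p (certified : certificate (+ suc d) c p ≡ true) where
        private
          rest : does (inner f (proj₁ (krylov p)) ℤ.≟ + suc d)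
               ∧ does (Vec.≡-dec ℤ._≟_ (proj₁ (krylov (c ∷ p))) (Vec.replicate n ℤ.0ℤ)) ≡ true
          rest = Bool.∧-conicalʳ (proj₂ (krylov p)) _ certified

        annihilated : proj₁ (krylov (c ∷ p)) ≡ Vec.replicate n ℤ.0ℤ
        annihilated = does-true (Vec.≡-dec ℤ._≟_ (proj₁ (krylov (c ∷ p))) (Vec.replicate n ℤ.0ℤ))
          (Bool.∧-conicalʳ (does (inner f (proj₁ (krylov p)) ℤ.≟ + suc d)) _ rest)

        quotient-eigenvector : ∀ {x} → eval (c ∷ p) x ≈ 0# → Eigenspace matrix x (quotient (c ∷ p) x)
        quotient-eigenvector {x} px≈0 i = begin
          (matrix · quotient (c ∷ p) x) i
            ≈⟨ ·-quotient (c ∷ p) x i ⟩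
          x * quotient (c ∷ p) x i + (cast (proj₁ (krylov (c ∷ p))) i - eval (c ∷ p) x * cast e i)
            ≈⟨ +-congˡ (+-cong (cast-zero (proj₁ (krylov (c ∷ p))) annihilated i)
                        (-‿cong (*-congʳ px≈0))) ⟩
          x * quotient (c ∷ p) x i + (0# - 0# * cast e i)
            ≈⟨ solve 2 (λ q e → q :+ (con (+ 0) :- con (+ 0) :* e) := q)
                 refl (x * quotient (c ∷ p) x i) (cast e i) ⟩
          x * quotient (c ∷ p) x i ∎

        quotient-nonzero : ∀ x → 0# < dot (quotient (c ∷ p) x) (quotient (c ∷ p) x)
        quotient-nonzero x = dot-pos⇒nonzero (cast f) (quotient (c ∷ p) x) (<-respʳ-≈ (sym dot≈d) (ι-pos d))
          where
          dot≈d : dot (cast f) (quotient (c ∷ p) x) ≈ ι (+ suc d)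
          dot≈d = begin
            dot (cast f) (quotient (c ∷ p) x)
              ≈⟨ dot-linear x (cast f) (cast (proj₁ (krylov p))) (quotient p x) ⟩
            dot (cast f) (cast (proj₁ (krylov p))) + x * dot (cast f) (quotient p x)
              ≈⟨ +-cong (dot-cast f (proj₁ (krylov p))) (*-congˡ (dot-quotient p x (Bool.∧-conicalˡ _ _ certified))) ⟩
            ι (inner f (proj₁ (krylov p))) + x * 0#
              ≈⟨ +-cong (reflexive (≡.cong ι (does-true (inner f (proj₁ (krylov p)) ℤ.≟ + suc d)
                   (Bool.∧-conicalˡ _ _ rest)))) (zeroʳ x) ⟩
            ι (+ suc d) + 0#
              ≈⟨ +-identityʳ _ ⟩
            ι (+ suc d) ∎

-- An eigenvalue κ with orthogonal integer eigenvectors us; a polynomial c ∷ p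
-- annihilating the integer vector e, with a root in each of the intervals
-- [left k / d , (left k + 1) / d]; and the functional f of Krylov.certificate.
record SpectralData (n m q r : ℕ) : Set where
  field
    c κ   : ℤ
    p     : List ℤ
    e f   : Vec ℤ n
    scale : ℕ
    den-1 : ℕ
    left  : Fin (q ℕ.+ r) → ℤ
    us    : Fin (suc m) → Vec ℤ n

  d : ℤ
  d = + suc den-1

  -- Index `zero` stands for κ, as a degenerate interval. Coming first, it counts among the `suc q`
  -- negative eigenvalues.
  lower : Fin (suc q ℕ.+ r) → ℤ
  lower zero    = κ ℤ.* d
  lower (suc k) = left k

  upper : Fin (suc q ℕ.+ r) → ℤ
  upper zero    = κ ℤ.* d
  upper (suc k) = ℤ.suc (left k)

  multiplicity : Fin (suc q ℕ.+ r) → ℕ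
  multiplicity zero    = suc m
  multiplicity (suc _) = 1

  negativeTotal positiveTotal : ℕ
  negativeTotal = ℕ.sum (List.tabulate (multiplicity ∘ (_↑ˡ r)))
  positiveTotal = ℕ.sum (List.tabulate (multiplicity ∘ (suc q ↑ʳ_)))

-- Each field is a decidable statement about integers, so evaluation establishes it without any
-- reals. The table `T` is a parameter so that the check can run on a table that is quick to compute
-- and be transported afterwards.
record IsSpectralCertificate {n m q r} (T : Vec (Vec Bool n) n) (D : SpectralData n m q r) : Set where
  open SpectralData D
  field
    certified   : Krylov.certificate T e f (+ suc scale) c p ≡ true
    us-eigen    : ∀ j → T ⊛ us j ≡ Vec.map (κ ℤ.*_) (us j)
    us-nonzero  : ∀ j → ℤ.0ℤ ℤ.< inner (us j) (us j)
    us-orth     : ∀ i j → i ≢ j → inner (us i) (us j) ≡ ℤ.0ℤ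
    sign-change : ∀ k → SignChange (c ∷ p) (left k) d ⊎ SignChange (List.map ℤ.-_ (c ∷ p)) (left k) d
    separated   : ∀ a b → a ≢ b → upper a ℤ.< lower b ⊎ upper b ℤ.< lower a
    negative    : ∀ i → upper (i ↑ˡ r) ℤ.< ℤ.0ℤ
    positive    : ∀ i → ℤ.0ℤ ℤ.< lower (suc q ↑ʳ i)
    total       : ℕ.sum (List.tabulate multiplicity) ≡ n

module _ (ℝ : Reals) where
  open Reals ℝ hiding (zero)
  open LinearAlgebra commutativeRing
  open OrderedField ℝ
  open Diagonalisation ℝ
  open IntegerCast commutativeRing
  open Solver using (solve; _:=_; _:*_; _:-_)
  open Roots ℝ using (eval; root-between)
  open IntegerMatrix ℝ

  module _ {n} (adjacent : Fin n → Fin n → Bool) (adjacent-sym : ∀ i j → adjacent i j ≡ adjacent j i)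
           {m q r} (D : SpectralData n m q r) (C : IsSpectralCertificate (table adjacent) D) where
    open SpectralData D
    open IsSpectralCertificate C

    private
      A : Matrix n
      A = matrix adjacent

      A-sym : ∀ i j → A i j ≈ A j i
      A-sym i j = reflexive (≡.cong bit (adjacent-sym i j))

      root : ∀ k → ∃[ l ] ι (left k) ≤ l * ι d × l * ι d ≤ ι (ℤ.suc (left k)) × eval (c ∷ p) l ≈ 0#
      root k = root-between (c ∷ p) (left k) d (ι-pos den-1) (sign-change k)

      eigenvalue : Fin (suc q ℕ.+ r) → Carrier
      eigenvalue zero    = ι κ
      eigenvalue (suc k) = proj₁ (root k)

      vector : ∀ a → Fin (multiplicity a) → Vector Carrier n
      vector zero    j = cast (us j)
      vector (suc k) _ = quotient adjacent e f (c ∷ p) (proj₁ (root k))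

      lower-bound : ∀ a → ι (lower a) ≤ eigenvalue a * ι d
      lower-bound zero    = ≤-reflexive (ι-* κ d)
      lower-bound (suc k) = proj₁ (proj₂ (root k))

      upper-bound : ∀ a → eigenvalue a * ι d ≤ ι (upper a)
      upper-bound zero    = ≤-reflexive (sym (ι-* κ d))
      upper-bound (suc k) = proj₁ (proj₂ (proj₂ (root k)))

      unscale-< : ∀ {x y} → x * ι d < y * ι d → x < y
      unscale-< {x} {y} xd<yd = 0<y-x⇒x<y (*-pos-cancelʳ (ι-pos den-1)
        (<-respʳ-≈ (solve 3 (λ x y d → y :* d :- x :* d := (y :- x) :* d) refl x y (ι d)) (x<y⇒0<y-x xd<yd)))

      ordered : ∀ a b → upper a ℤ.< lower b → eigenvalue a < eigenvalue b
      ordered a b u<l = unscale-< (≤-<-trans (upper-bound a) (<-≤-trans (ι-mono-< u<l) (lower-bound b)))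

      basis : OrthogonalEigenbasis A (q ℕ.+ r)
      basis = record
        { eigenvalue   = eigenvalue
        ; multiplicity = multiplicity
        ; vector       = vector
        ; eigenvector  = λ
            { zero    j → integer-eigenvector adjacent κ (us j) (us-eigen j)
            ; (suc k) _ → quotient-eigenvector adjacent e f scale c p certified (proj₂ (proj₂ (proj₂ (root k)))) }
        ; apart        = λ a b a≢b → Sum.map (ordered a b) (ordered b a) (separated a b a≢b)
        ; orthogonal   = λ
            { zero    i j i≢j → trans (dot-cast (us i) (us j)) (reflexive (≡.cong ι (us-orth i j i≢j)))
            ; (suc k) zero zero 0≢0 → contradiction ≡.refl 0≢0 }
        ; nonzero      = λ
            { zero    j → <-respʳ-≈ (sym (dot-cast (us j) (us j))) (ι-mono-< (us-nonzero j))
            ; (suc k) _ → quotient-nonzero adjacent e f scale c p certified (proj₁ (root k)) }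
        ; inhabited    = λ { zero → zero ; (suc k) → zero }
        ; total        = total
        }

      negative-eigenvalue : ∀ i → eigenvalue (i ↑ˡ r) < 0#
      negative-eigenvalue i = unscale-< (≤-<-trans (upper-bound (i ↑ˡ r))
        (<-respʳ-≈ (sym (zeroˡ (ι d))) (ι-mono-< (negative i))))

      positive-eigenvalue : ∀ i → 0# < eigenvalue (suc q ↑ʳ i)
      positive-eigenvalue i = unscale-< (<-≤-trans
        (<-respˡ-≈ (sym (zeroˡ (ι d))) (ι-mono-< (positive i))) (lower-bound (suc q ↑ʳ i)))

      index-sign : ∀ a → (∃[ i ] a ≡ i ↑ˡ r) ⊎ (∃[ i ] a ≡ suc q ↑ʳ i)
      index-sign a = by-side (Fin.splitAt (suc q) a) (≡.sym (Fin.join-splitAt (suc q) r a))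
        where
        by-side : ∀ s → a ≡ Fin.join (suc q) r s → (∃[ i ] a ≡ i ↑ˡ r) ⊎ (∃[ i ] a ≡ suc q ↑ʳ i)
        by-side (inj₁ i) eq = inj₁ (i , eq)
        by-side (inj₂ i) eq = inj₂ (i , eq)

    count-positive : EigenvalueCount A (0# <_) positiveTotal
    count-positive = eigenvalue-count A-sym basis (0# <_) <-respʳ-≈ (suc q ↑ʳ_)
      (λ i j i≢j → i≢j ∘ Fin.↑ʳ-injective (suc q) i j) positive-eigenvalue
      (λ a 0<λ → Sum.[ (λ { (i , ≡.refl) → contradiction 0<λ (<-asym (negative-eigenvalue i)) }) , id ]
                   (index-sign a))

    count-negative : EigenvalueCount A (_< 0#) negativeTotal
    count-negative = eigenvalue-count A-sym basis (_< 0#) <-respˡ-≈ (_↑ˡ r)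
      (λ i j i≢j → i≢j ∘ Fin.↑ˡ-injective r i j) negative-eigenvalue
      (λ a λ<0 → Sum.[ id , (λ { (i , ≡.refl) → contradiction λ<0 (<-asym (positive-eigenvalue i)) }) ]
                   (index-sign a))

    count-zero : EigenvalueCount A (_≈ 0#) 0
    count-zero = eigenvalue-count A-sym basis {0} (_≈ 0#) (λ x≈y x≈0 → trans (sym x≈y) x≈0) (λ ())
      (λ ()) (λ ()) (λ a λ≈0 → ⊥-elim (nonzero a λ≈0))
      where
      nonzero : ∀ a → ¬ (eigenvalue a ≈ 0#)
      nonzero a λ≈0 = Sum.[ (λ { (i , ≡.refl) → <-irrefl λ≈0 (negative-eigenvalue i) })
                          , (λ { (i , ≡.refl) → <-irrefl (sym λ≈0) (positive-eigenvalue i) }) ] (index-sign a)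

open SpectralData using (positiveTotal; negativeTotal)

-- Graphs given by a list of edges

-- The notions of Defs for an arbitrary list of edges, so that the filtered list
-- Graph.edges G₄₈ can be replaced by a literal one.
module EdgeList {n} (es : List (Fin n × Fin n)) where

  Edge : Set
  Edge = Fin (length es)

  Incident : Fin n → Edge → Set
  Incident v e = v ≡ proj₁ (lookup es e) ⊎ v ≡ proj₂ (lookup es e)

  incident? : ∀ v e → Dec (Incident v e)
  incident? v e = (v Fin.≟ proj₁ (lookup es e)) ⊎-dec (v Fin.≟ proj₂ (lookup es e))

  Meet : Edge → Edge → Set
  Meet e f = e ≢ f × ∃[ v ] (Incident v e × Incident v f)

  meet? : ∀ e f → Dec (Meet e f)
  meet? e f = ¬? (e Fin.≟ f) ×-dec Fin.any? (λ v → incident? v e ×-dec incident? v f)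

  ShareEndpoint : Fin n × Fin n → Fin n × Fin n → Set
  ShareEndpoint (a , b) (c , d) = (a ≡ c ⊎ a ≡ d) ⊎ (b ≡ c ⊎ b ≡ d)

  -- Equivalent to meet?, but without a search over the vertices.
  meet-fast? : ∀ e f → Dec (e ≢ f × ShareEndpoint (lookup es e) (lookup es f))
  meet-fast? e f = ¬? (e Fin.≟ f) ×-dec share? (lookup es e) (lookup es f)
    where
    share? : ∀ x y → Dec (ShareEndpoint x y)
    share? (a , b) (c , d) = ((a Fin.≟ c) ⊎-dec (a Fin.≟ d)) ⊎-dec ((b Fin.≟ c) ⊎-dec (b Fin.≟ d))

  meet≡meet-fast : ∀ e f → does (meet? e f) ≡ does (meet-fast? e f)
  meet≡meet-fast e f = does-⇔ (mk⇔ to from) (meet? e f) (meet-fast? e f)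
    where
    to : Meet e f → e ≢ f × ShareEndpoint (lookup es e) (lookup es f)
    to (e≢f , v , inj₁ ≡.refl , q) = e≢f , inj₁ q
    to (e≢f , v , inj₂ ≡.refl , q) = e≢f , inj₂ q
    from : e ≢ f × ShareEndpoint (lookup es e) (lookup es f) → Meet e f
    from (e≢f , inj₁ q) = e≢f , _ , inj₁ ≡.refl , q
    from (e≢f , inj₂ q) = e≢f , _ , inj₂ ≡.refl , q

  meet : Edge → Edge → Bool
  meet e f = does (meet? e f)

  meet-sym : ∀ e f → meet e f ≡ meet f e
  meet-sym e f = does-⇔ (mk⇔ flip flip) (meet? e f) (meet? f e)
    where
    flip : ∀ {e f} → Meet e f → Meet f e
    flip (e≢f , v , p , q) = (λ f≡e → e≢f (≡.sym f≡e)) , v , q , p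

  fastTable : Vec (Vec Bool (length es)) (length es)
  fastTable = Vec.tabulate (λ e → Vec.tabulate (λ f → does (meet-fast? e f)))

  module _ (ℝ : Reals) where
    open Reals ℝ hiding (zero)
    open LinearAlgebra commutativeRing

    fastTable≡table : fastTable ≡ IntegerMatrix.table ℝ meet
    fastTable≡table = ≡.sym (Vec.tabulate-cong (λ e → Vec.tabulate-cong (meet≡meet-fast e)))

    HasInertia : ℕ × ℕ × ℕ → Set
    HasInertia (p , z , q) =
      EigenvalueCount A (0# <_) p × EigenvalueCount A (_≈ 0#) z × EigenvalueCount A (_< 0#) q
      where
      A : Matrix (length es)
      A e f = if meet e f then 1# else 0#

    has-inertia : ∀ {m q r} (D : SpectralData (length es) m q r) → IsSpectralCertificate fastTable D →
                  HasInertia (positiveTotal D , 0 , negativeTotal D)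
    has-inertia D C = count-positive ℝ meet meet-sym D C′
                    , count-zero ℝ meet meet-sym D C′
                    , count-negative ℝ meet meet-sym D C′
      where
      C′ : IsSpectralCertificate (IntegerMatrix.table ℝ meet) D
      C′ = ≡.subst (λ T → IsSpectralCertificate T D) fastTable≡table C

-- For variable `G` and `es`, matching on the equation makes both notions definitionally equal
-- without evaluating the filtered edge list.
lineGraph-inertia : ∀ ℝ G {es} → es ≡ Graph.edges G → ∀ {t} →
                    EdgeList.HasInertia es ℝ t → Spectral.HasInertia ℝ (lineGraph G) t
lineGraph-inertia ℝ G ≡.refl inertia = inertia

-- Cycle spaces over 𝔽₂

module 𝔽₂ where
  open LinearAlgebra Bool.xor-∧-commutativeRing public
  open Sums Bool.xor-∧-commutativeRing public

  sum-true : ∀ {n} (f : Vector Bool n) → sum f ≡ true → ∃[ i ] f i ≡ true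
  sum-true {suc n} f eq with f zero in f₀
  ... | true  = zero , f₀
  ... | false = let i , fᵢ = sum-true (f ∘ suc) eq in suc i , fᵢ

  xor≡false⇒≡ : ∀ x y → x xor y ≡ false → x ≡ y
  xor≡false⇒≡ false y eq = ≡.sym eq
  xor≡false⇒≡ true  y eq = ≡.sym (Bool.not-injective eq)

module CycleSpaceOf (G : Graph) (es : List (Graph.Vertex G × Graph.Vertex G)) where
  open Graph G using (Vertex)
  open EdgeList es
  open 𝔽₂

  private
    _≟_ : (x y : Vertex × Vertex) → Dec (x ≡ y)
    _≟_ = ≡-dec Fin._≟_ Fin._≟_

  Traverses : Edge → Vertex × Vertex → Set
  Traverses e (u , v) = (u , v) ≡ lookup es e ⊎ (v , u) ≡ lookup es e

  traverses? : ∀ e s → Dec (Traverses e s)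
  traverses? e (u , v) = ((u , v) ≟ lookup es e) ⊎-dec ((v , u) ≟ lookup es e)

  edgesOf : List (Vertex × Vertex) → Vector Bool (length es)
  edgesOf steps e = does (any? (traverses? e) steps)

  stepsOf : Cycle G → List (Vertex × Vertex)
  stepsOf C = closedSteps G (Cycle.vertices C)

  Even : Vector Bool (length es) → Set
  Even S = ∀ v → sum (λ e → if does (incident? v e) then S e else false) ≡ false

  even? : ∀ S → Dec (Even S)
  even? S = Fin.all? (λ v → sum (λ e → if does (incident? v e) then S e else false) Bool.≟ false)

  IsCycleBasisOf : List (Cycle G) → Set
  IsCycleBasisOf B = IsBasis Even (λ i → edgesOf (stepsOf (lookup B i)))

  IsMinimumCycleBasisOf : List (Cycle G) → Set
  IsMinimumCycleBasisOf B = IsCycleBasisOf B × (∀ B′ → IsCycleBasisOf B′ → totalLength G B ℕ.≤ totalLength G B′)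

  incidence : Vertex → Vector Bool (length es)
  incidence v e = does (incident? v e)

  even⇒dot≡false : ∀ S → Even S → ∀ v → dot S (incidence v) ≡ false
  even⇒dot≡false S even v = ≡.trans (sum-cong-≋ (λ e → ∧-if (incidence v e) (S e))) (even v)
    where
    ∧-if : ∀ b s → s ∧ b ≡ (if b then s else false)
    ∧-if true  s = Bool.∧-identityʳ s
    ∧-if false s = Bool.∧-zeroʳ s

  -- The sum of the stars of the vertices in `T` is the cut of `T`, because an edge inside `T` is
  -- counted twice. A loop would be counted once, hence the hypothesis.
  combination-incidence : (∀ e → proj₁ (lookup es e) ≢ proj₂ (lookup es e)) → ∀ T e →
    combination T incidence e ≡ T (proj₁ (lookup es e)) xor T (proj₂ (lookup es e))
  combination-incidence loopless T e = begin
    sum (λ v → T v ∧ incidence v e)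
      ≡⟨ sum-cong-≋ split ⟩
    sum (λ v → (indicator a v ∧ T v) xor (indicator b v ∧ T v))
      ≡⟨ ∑-distrib-+ (λ v → indicator a v ∧ T v) (λ v → indicator b v ∧ T v) ⟩
    dot (indicator a) T xor dot (indicator b) T
      ≡⟨ ≡.cong₂ _xor_ (dot-indicator a T) (dot-indicator b T) ⟩
    T a xor T b ∎
    where
    open ≡.≡-Reasoning
    a b : Vertex
    a = proj₁ (lookup es e)
    b = proj₂ (lookup es e)
    split : ∀ v → T v ∧ incidence v e ≡ (indicator a v ∧ T v) xor (indicator b v ∧ T v)
    -- `incidence` and `indicator` test the same equalities in opposite directions, so both
    -- directions have to be split.
    split v with v Fin.≟ a | v Fin.≟ b | a Fin.≟ v | b Fin.≟ v
    ... | yes v≡a | yes v≡b | _       | _       = contradiction (≡.trans (≡.sym v≡a) v≡b) (loopless e)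
    ... | yes v≡a | no  _   | no  a≢v | _       = contradiction (≡.sym v≡a) a≢v
    ... | no  v≢a | _       | yes a≡v | _       = contradiction (≡.sym a≡v) v≢a
    ... | _       | yes v≡b | _       | no  b≢v = contradiction (≡.sym v≡b) b≢v
    ... | _       | no  v≢b | _       | yes b≡v = contradiction (≡.sym b≡v) v≢b
    ... | yes _   | no  _   | yes _   | no  _   = ≡.trans (Bool.∧-identityʳ (T v)) (≡.sym (Bool.xor-identityʳ (T v)))
    ... | no  _   | yes _   | no  _   | yes _   = Bool.∧-identityʳ (T v)
    ... | no  _   | no  _   | no  _   | no  _   = Bool.∧-zeroʳ (T v)

  -- The edges leaving the vertex set cut e are e itself and the edges rep j for
  -- those j with b j e, and an even set meets every cut in an even number of edges.
  module _ {k} (b : Fin k → Vector Bool (length es)) (rep : Fin k → Edge) (cut : Edge → Vector Bool (Graph.order G))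
           (loopless : ∀ e → proj₁ (lookup es e) ≢ proj₂ (lookup es e))
           (cut-edges : ∀ e f → cut e (proj₁ (lookup es f)) xor cut e (proj₂ (lookup es f))
                              ≡ indicator e f xor combination (λ j → b j e) (indicator ∘ rep) f) where

    even-spanned : ∀ S → Even S → S ≋ combination (S ∘ rep) b
    even-spanned S even e = xor≡false⇒≡ _ _ (≡.trans (≡.sym dot-cut) dot-cut≡false)
      where
      open CommutativeRing Bool.xor-∧-commutativeRing using (setoid; +-cong; distribˡ)
      open import Relation.Binary.Reasoning.Setoid setoid
      dot-cut≡false : dot S (combination (cut e) incidence) ≡ false
      dot-cut≡false = ≡.trans (dot-combinationʳ S (cut e) incidence)
        (sum-zero (λ v → cut e v ∧ dot S (incidence v))
          (λ v → ≡.trans (≡.cong (cut e v ∧_) (even⇒dot≡false S even v)) (Bool.∧-zeroʳ (cut e v))))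
      dot-cut : dot S (combination (cut e) incidence) ≡ S e xor combination (S ∘ rep) b e
      dot-cut = begin
        dot S (combination (cut e) incidence)
          ≈⟨ dot-cong {u = S} (λ _ → ≡.refl) (λ f → ≡.trans (combination-incidence loopless (cut e) f) (cut-edges e f)) ⟩
        sum (λ f → S f ∧ (indicator e f xor combination (λ j → b j e) (indicator ∘ rep) f))
          ≈⟨ sum-cong-≋ (λ f → distribˡ (S f) (indicator e f) (combination (λ j → b j e) (indicator ∘ rep) f)) ⟩
        sum (λ f → (S f ∧ indicator e f) xor (S f ∧ combination (λ j → b j e) (indicator ∘ rep) f))
          ≈⟨ ∑-distrib-+ (λ f → S f ∧ indicator e f) (λ f → S f ∧ combination (λ j → b j e) (indicator ∘ rep) f) ⟩
        dot S (indicator e) xor dot S (combination (λ j → b j e) (indicator ∘ rep))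
          ≈⟨ +-cong (dot-indicatorʳ e) (dot-combinationʳ S (λ j → b j e) (indicator ∘ rep)) ⟩
        S e xor sum (λ j → b j e ∧ dot S (indicator (rep j)))
          ≈⟨ ≡.cong (S e xor_) (sum-cong-≋ (λ j →
               ≡.trans (≡.cong (b j e ∧_) (dot-indicatorʳ (rep j))) (Bool.∧-comm (b j e) (S (rep j))))) ⟩
        S e xor combination (S ∘ rep) b e ∎
        where
        dot-indicatorʳ : ∀ f → dot S (indicator f) ≡ S f
        dot-indicatorʳ f = ≡.trans (dot-comm S (indicator f)) (dot-indicator f S)

    -- By `b-rep`, evaluation at the edges `rep i` reads off the coefficients of a combination; this
    -- gives independence and the coefficients for spanning.
    isBasis : (∀ j → Even (b j)) → (∀ i j → b j (rep i) ≡ indicator i j) → IsBasis Even b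
    isBasis even b-rep = record
      { member      = even
      ; independent = λ a a·b≋0 i → ≡.trans (≡.sym (coordinate a i)) (a·b≋0 (rep i))
      ; spanning    = λ S even → S ∘ rep , even-spanned S even
      }
      where
      coordinate : ∀ a i → combination a b (rep i) ≡ a i
      coordinate a i = ≡.trans
        (sum-cong-≋ (λ j → ≡.trans (≡.cong (a j ∧_) (b-rep i j)) (Bool.∧-comm (a j) (indicator i j))))
        (dot-indicator i a)

  length-closedSteps : ∀ vs → length (closedSteps G vs) ≡ length vs
  length-closedSteps []       = ≡.refl
  length-closedSteps (v ∷ vs) = ≡.trans (List.length-zipWith _,_ (v ∷ vs) (vs List.∷ʳ v))
    (≡.trans (≡.cong (length (v ∷ vs) ℕ.⊓_) (≡.trans (List.length-++ vs) (ℕ.+-comm (length vs) 1)))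
             (ℕ.⊓-idem (length (v ∷ vs))))

  allSteps : List (Cycle G) → List (Vertex × Vertex)
  allSteps B = concat (map stepsOf B)

  length-allSteps : ∀ B → length (allSteps B) ≡ totalLength G B
  length-allSteps []      = ≡.refl
  length-allSteps (C ∷ B) = ≡.trans (List.length-++ (stepsOf C))
    (≡.cong₂ ℕ._+_ (length-closedSteps (Cycle.vertices C)) (length-allSteps B))

  -- Distinct edges are traversed by distinct steps.
  totalLength-≥ : ∀ {k} (f : Fin k → Edge) →
    (∀ i j → i ≢ j → lookup es (f i) ≢ lookup es (f j) × lookup es (f i) ≢ swap (lookup es (f j))) →
    (∀ i → ∃[ S ] Even S × S (f i) ≡ true) →
    ∀ B → IsCycleBasisOf B → k ℕ.≤ totalLength G B
  totalLength-≥ {k} f distinct covered B basis =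
    ≡.subst (k ℕ.≤_) (length-allSteps B) (Fin.injective⇒≤ {f = Any.index ∘ traversed} injective)
    where
    traversed : ∀ i → Any (Traverses (f i)) (allSteps B)
    traversed i =
      let S , even , Sfᵢ = covered i
          a , S≋ab = IsBasis.spanning basis S even
          -- A true sum over 𝔽₂ has a true summand, which names a basis cycle passing through `f i`.
          j , ajbj = sum-true (λ j → a j ∧ edgesOf (stepsOf (lookup B j)) (f i)) (≡.trans (≡.sym (S≋ab (f i))) Sfᵢ)
      in Any.concat⁺ (Any.map⁺ {f = stepsOf} {xs = B} (lose (∈-lookup {xs = B} j)
           (does-true (any? (traverses? (f i)) (stepsOf (lookup B j)))
           (Bool.∧-conicalʳ (a j) _ ajbj))))

    same-step : ∀ i j s → Traverses (f i) s → Traverses (f j) s → i ≡ j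
    same-step i j s p q with i Fin.≟ j
    ... | yes i≡j = i≡j
    ... | no  i≢j = contradiction p (disagree q)
      where
      disagree : Traverses (f j) s → ¬ Traverses (f i) s
      disagree (inj₁ q) (inj₁ p) = proj₁ (distinct i j i≢j) (≡.trans (≡.sym p) q)
      disagree (inj₂ q) (inj₂ p) = proj₁ (distinct i j i≢j) (≡.trans (≡.sym p) q)
      disagree (inj₁ q) (inj₂ p) = proj₂ (distinct i j i≢j) (≡.trans (≡.sym p) (≡.cong swap q))
      disagree (inj₂ q) (inj₁ p) = proj₂ (distinct i j i≢j) (≡.trans (≡.sym p) (≡.cong swap q))

    injective : ∀ {i j} → Any.index (traversed i) ≡ Any.index (traversed j) → i ≡ j
    injective {i} {j} eq = same-step i j _ (Any.lookup-index (traversed i))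
      (≡.subst (λ t → Traverses (f j) (lookup (allSteps B) t)) (≡.sym eq) (Any.lookup-index (traversed j)))

isMinimumCycleBasis : ∀ G {es} → es ≡ Graph.edges G → ∀ B →
                      CycleSpaceOf.IsMinimumCycleBasisOf G es B → IsMinimumCycleBasis G B
isMinimumCycleBasis G ≡.refl B minimum = minimum

-- The graph G₄₈

open Graph G₄₈ using (Vertex; edges)

edgeList : List (Vertex × Vertex)
edgeList =
    (# 0 , # 1) ∷ (# 0 , # 2) ∷ (# 0 , # 3) ∷ (# 1 , # 5) ∷ (# 1 , # 12) ∷ (# 1 , # 13)
  ∷ (# 2 , # 12) ∷ (# 3 , # 16) ∷ (# 3 , # 24) ∷ (# 4 , # 5) ∷ (# 4 , # 6) ∷ (# 5 , # 7)
  ∷ (# 5 , # 8) ∷ (# 6 , # 31) ∷ (# 7 , # 25) ∷ (# 9 , # 10) ∷ (# 9 , # 11) ∷ (# 11 , # 14)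
  ∷ (# 11 , # 15) ∷ (# 13 , # 22) ∷ (# 13 , # 28) ∷ (# 14 , # 26) ∷ (# 15 , # 27) ∷ (# 16 , # 17)
  ∷ (# 17 , # 29) ∷ (# 17 , # 30) ∷ (# 18 , # 19) ∷ (# 19 , # 20) ∷ (# 20 , # 31) ∷ (# 21 , # 22)
  ∷ (# 21 , # 23) ∷ (# 24 , # 43) ∷ (# 25 , # 26) ∷ (# 26 , # 27) ∷ (# 28 , # 32) ∷ (# 29 , # 37)
  ∷ (# 30 , # 38) ∷ (# 30 , # 39) ∷ (# 32 , # 46) ∷ (# 33 , # 34) ∷ (# 33 , # 35) ∷ (# 34 , # 36)
  ∷ (# 36 , # 43) ∷ (# 37 , # 39) ∷ (# 38 , # 40) ∷ (# 38 , # 41) ∷ (# 40 , # 42) ∷ (# 41 , # 44)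
  ∷ (# 44 , # 45) ∷ (# 46 , # 47) ∷ []

edges≡edgeList : edges ≡ edgeList
edges≡edgeList = ≡.refl

-- Spectral data of the line graph

pos neg : ℕ → ℤ
pos n = + n
neg n = ℤ.- (+ n)

-- (+ 4) ∷ p₄₈ is the minimal polynomial over A = A(L(G₄₈)) of the basis
-- vector of the edge (9 , 10); the characteristic polynomial of A is
-- (x + 2)² times it.
p₄₈ : List ℤ
p₄₈ =
    neg 300 ∷ pos 7057 ∷ neg 66656 ∷ pos 182179 ∷ pos 894594 ∷ neg 5118416 ∷ neg 3451168
  ∷ pos 50838733 ∷ neg 6073312 ∷ neg 293572793 ∷ pos 103373528 ∷ pos 1140111740 ∷ neg 440728918
  ∷ neg 3186008747 ∷ pos 1074002744 ∷ pos 6651837415 ∷ neg 1690749362 ∷ neg 10620329400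
  ∷ pos 1726388474 ∷ pos 13168166038 ∷ neg 977738726 ∷ neg 12813574044 ∷ neg 69082524
  ∷ pos 9855147796 ∷ pos 733698340 ∷ neg 6018090819 ∷ neg 798142088 ∷ pos 2924549564
  ∷ pos 527134858 ∷ neg 1131350197 ∷ neg 246287980 ∷ pos 347810499 ∷ pos 85237436 ∷ neg 84648498
  ∷ neg 22174702 ∷ pos 16202627 ∷ pos 4331586 ∷ neg 2414124 ∷ neg 626610 ∷ pos 275424 ∷ pos 65196
  ∷ neg 23404 ∷ neg 4620 ∷ pos 1408 ∷ pos 200 ∷ neg 54 ∷ neg 4 ∷ pos 1 ∷ []

-- Number 15 is the pendant edge (9 , 10). The vectors of `kernel₄₈` vanish there, so `e₄₈` lies in
-- the 48-dimensional orthogonal complement of their span.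
e₄₈ : Vec ℤ 50
e₄₈ = Vec.replicate 50 ℤ.0ℤ Vec.[ # 15 ]≔ ℤ.1ℤ

-- A solution of the linear system expressed by Krylov.certificate.
f₄₈ : Vec ℤ 50
f₄₈ =
    pos 19655414356 ∷ neg 87254100 ∷ neg 19206602726 ∷ neg 18611404862 ∷ neg 291900158
  ∷ neg 705234868 ∷ pos 0 ∷ pos 24070588556 ∷ neg 5156189496 ∷ neg 258130632 ∷ pos 204192888
  ∷ pos 18868251262 ∷ pos 1284232 ∷ neg 115580880 ∷ neg 18862472218 ∷ pos 0 ∷ pos 0
  ∷ pos 9411009455 ∷ neg 9411009455 ∷ pos 372128580 ∷ pos 92003944 ∷ neg 9416788499
  ∷ pos 9416788499 ∷ neg 24445145674 ∷ neg 180143976 ∷ pos 24051563544 ∷ pos 77053920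
  ∷ neg 127138968 ∷ pos 104022792 ∷ pos 117233352 ∷ neg 258330492 ∷ pos 5501012802
  ∷ pos 18852840478 ∷ neg 9426420239 ∷ neg 171539712 ∷ pos 805513298 ∷ neg 21346709304
  ∷ neg 1206669838 ∷ pos 379039616 ∷ neg 2580245712 ∷ pos 1683634854 ∷ pos 3230383806
  ∷ neg 4535303676 ∷ pos 0 ∷ pos 6427800616 ∷ pos 11971830270 ∷ neg 3512017726 ∷ neg 8031597196
  ∷ pos 4449617482 ∷ neg 337690004 ∷ []

-- 512 times the left ends of intervals of length 1/512 isolating the roots.
left₄₈ : Vec ℤ 48
left₄₈ =
    neg 1017 ∷ neg 1003 ∷ neg 997 ∷ neg 994 ∷ neg 949 ∷ neg 945 ∷ neg 927 ∷ neg 886 ∷ neg 878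
  ∷ neg 814 ∷ neg 803 ∷ neg 780 ∷ neg 711 ∷ neg 692 ∷ neg 640 ∷ neg 637 ∷ neg 504 ∷ neg 448
  ∷ neg 395 ∷ neg 379 ∷ neg 363 ∷ neg 241 ∷ pos 12 ∷ pos 36 ∷ pos 57 ∷ pos 73 ∷ pos 153 ∷ pos 180
  ∷ pos 253 ∷ pos 327 ∷ pos 438 ∷ pos 442 ∷ pos 475 ∷ pos 547 ∷ pos 579 ∷ pos 582 ∷ pos 631
  ∷ pos 741 ∷ pos 857 ∷ pos 891 ∷ pos 971 ∷ pos 1007 ∷ pos 1092 ∷ pos 1257 ∷ pos 1385 ∷ pos 1445
  ∷ pos 1558 ∷ pos 2037 ∷ []

-- Spans the kernel of the incidence matrix B, hence of A + 2 = Bᵀ B: alternating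
-- signs along the square, and along a closed walk through the two pentagons,
-- the latter made orthogonal to the former.
kernel₄₈ : Fin 2 → Vec ℤ 50
kernel₄₈ zero =
    pos 1 ∷ neg 1 ∷ pos 0 ∷ pos 0 ∷ neg 1 ∷ pos 0 ∷ pos 1 ∷ pos 0 ∷ pos 0 ∷ pos 0 ∷ pos 0 ∷ pos 0
  ∷ pos 0 ∷ pos 0 ∷ pos 0 ∷ pos 0 ∷ pos 0 ∷ pos 0 ∷ pos 0 ∷ pos 0 ∷ pos 0 ∷ pos 0 ∷ pos 0 ∷ pos 0
  ∷ pos 0 ∷ pos 0 ∷ pos 0 ∷ pos 0 ∷ pos 0 ∷ pos 0 ∷ pos 0 ∷ pos 0 ∷ pos 0 ∷ pos 0 ∷ pos 0 ∷ pos 0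
  ∷ pos 0 ∷ pos 0 ∷ pos 0 ∷ pos 0 ∷ pos 0 ∷ pos 0 ∷ pos 0 ∷ pos 0 ∷ pos 0 ∷ pos 0 ∷ pos 0 ∷ pos 0
  ∷ pos 0 ∷ pos 0 ∷ []
kernel₄₈ (suc _) =
    neg 3 ∷ neg 1 ∷ pos 4 ∷ pos 4 ∷ neg 1 ∷ pos 0 ∷ pos 1 ∷ neg 4 ∷ pos 0 ∷ pos 0 ∷ pos 0 ∷ neg 4
  ∷ pos 0 ∷ pos 0 ∷ pos 4 ∷ pos 0 ∷ pos 0 ∷ neg 2 ∷ pos 2 ∷ pos 0 ∷ pos 0 ∷ pos 2 ∷ neg 2 ∷ pos 4
  ∷ neg 2 ∷ neg 2 ∷ pos 0 ∷ pos 0 ∷ pos 0 ∷ pos 0 ∷ pos 0 ∷ pos 0 ∷ neg 4 ∷ pos 2 ∷ pos 0 ∷ pos 2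
  ∷ pos 0 ∷ pos 2 ∷ pos 0 ∷ pos 0 ∷ pos 0 ∷ pos 0 ∷ pos 0 ∷ neg 2 ∷ pos 0 ∷ pos 0 ∷ pos 0 ∷ pos 0
  ∷ pos 0 ∷ pos 0 ∷ []

data₄₈ : SpectralData 50 1 22 26
data₄₈ = record
  -- `scale` and `den-1` hold predecessors, so that 3852696 and 512 are positive by construction.
  -- 512 is the least power of two that works: over 256 the intervals of the roots in
  -- [-640/512, -639/512] and [-637/512, -636/512] would touch at -319/256.
  { c = + 4 ; κ = neg 2 ; p = p₄₈ ; e = e₄₈ ; f = f₄₈ ; scale = 3852695 ; den-1 = 511
  ; left = Vec.lookup left₄₈ ; us = kernel₄₈ }

module _ where
  open EdgeList edgeList using (fastTable)
  open SpectralData data₄₈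

  certificate₄₈ : IsSpectralCertificate fastTable data₄₈
  certificate₄₈ = record
    { certified   = ≡.refl
    ; us-eigen    = toWitness {a? = Fin.all? λ j → Vec.≡-dec ℤ._≟_ (fastTable ⊛ us j) (Vec.map (κ ℤ.*_) (us j))} _
    ; us-nonzero  = toWitness {a? = Fin.all? λ j → ℤ.0ℤ ℤ.<? inner (us j) (us j)} _
    ; us-orth     = toWitness {a? = Fin.all? λ i → Fin.all? λ j →
        ¬? (i Fin.≟ j) →-dec (inner (us i) (us j) ℤ.≟ ℤ.0ℤ)} _
    ; sign-change = toWitness {a? = Fin.all? λ k →
        sign-change? (c ∷ p) (left k) ⊎-dec sign-change? (List.map ℤ.-_ (c ∷ p)) (left k)} _
    ; separated   = toWitness {a? = Fin.all? λ a → Fin.all? λ b →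
        ¬? (a Fin.≟ b) →-dec ((upper a ℤ.<? lower b) ⊎-dec (upper b ℤ.<? lower a))} _
    ; negative    = toWitness {a? = Fin.all? λ i → upper (i ↑ˡ 26) ℤ.<? ℤ.0ℤ} _
    ; positive    = toWitness {a? = Fin.all? λ i → ℤ.0ℤ ℤ.<? lower (23 ↑ʳ i)} _
    ; total       = ≡.refl
    }
    where
    sign-change? : ∀ p n → Dec (SignChange p n d)
    sign-change? p n = (homogeneous p n d ℤ.≤? ℤ.0ℤ) ×-dec (ℤ.0ℤ ℤ.≤? homogeneous p (ℤ.suc n) d)

inertia : ∀ ℝ → Spectral.HasInertia ℝ (lineGraph G₄₈) (26 , 0 , 24)
inertia ℝ = lineGraph-inertia ℝ G₄₈ (≡.sym edges≡edgeList) (EdgeList.has-inertia edgeList ℝ data₄₈ certificate₄₈)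

-- Connectedness and absence of triangles

open Graph G₄₈ using (Adj; adj?; Connected; TriangleFree)

-- A breadth-first spanning tree, with root 0.
parents : Vec Vertex 48
parents =
    # 0 ∷ # 0 ∷ # 0 ∷ # 0 ∷ # 5 ∷ # 1 ∷ # 4 ∷ # 5 ∷ # 5 ∷ # 11 ∷ # 9 ∷ # 14
  ∷ # 1 ∷ # 1 ∷ # 26 ∷ # 27 ∷ # 3 ∷ # 16 ∷ # 19 ∷ # 20 ∷ # 31 ∷ # 22 ∷ # 13 ∷ # 21
  ∷ # 3 ∷ # 7 ∷ # 25 ∷ # 26 ∷ # 13 ∷ # 17 ∷ # 17 ∷ # 6 ∷ # 28 ∷ # 34 ∷ # 36 ∷ # 33
  ∷ # 43 ∷ # 29 ∷ # 30 ∷ # 30 ∷ # 38 ∷ # 38 ∷ # 40 ∷ # 24 ∷ # 41 ∷ # 44 ∷ # 32 ∷ # 46 ∷ []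

parent : Vertex → Vertex
parent = Vec.lookup parents

-- All paths get the same length, below the depth 9 of the tree, attained at vertex 10. The root is
-- its own parent, so shorter paths are padded with the step (0 , 0), which traverses no edge.
pathToRoot : ℕ → Vertex → List (Vertex × Vertex)
pathToRoot zero    v = []
pathToRoot (suc k) v = (v , parent v) ∷ pathToRoot k (parent v)

ancestor : ℕ → Vertex → Vertex
ancestor zero    v = v
ancestor (suc k) v = ancestor k (parent v)

star-ancestor : ∀ k v → Star Adj v (ancestor k v)
star-ancestor zero    v = Star.ε
star-ancestor (suc k) v = step (parent-adjacent v)
  where
  parent-adjacent : ∀ v → Adj v (parent v) ⊎ v ≡ parent v
  parent-adjacent = toWitness {a? = Fin.all? λ v → adj? v (parent v) ⊎-dec (v Fin.≟ parent v)} _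
  step : Adj v (parent v) ⊎ v ≡ parent v → Star Adj v (ancestor (suc k) v)
  step (inj₁ adj) = adj ◅ star-ancestor k (parent v)
  step (inj₂ eq)  = ≡.subst (λ u → Star Adj u (ancestor k (parent v))) (≡.sym eq) (star-ancestor k (parent v))

connected : Connected
connected u v = to-root u ◅◅ reverse (Graph.symm G₄₈) (to-root v)
  where
  ancestor≡root : ∀ v → ancestor 9 v ≡ # 0
  ancestor≡root = toWitness {a? = Fin.all? λ v → ancestor 9 v Fin.≟ # 0} _
  to-root : ∀ v → Star Adj v (# 0)
  to-root v = ≡.subst (Star Adj v) (ancestor≡root v) (star-ancestor 9 v)

-- Both orientations of every edge. Testing pairs of consecutive arcs replaces a search through all
-- 48³ triples of vertices.
arcs₄₈ : List (ℕ × ℕ)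
arcs₄₈ = edges₄₈ ++ map swap edges₄₈

_∈arcs? : ∀ x → Dec (x ∈ arcs₄₈)
x ∈arcs? = DecMembership._∈?_ (≡-dec ℕ._≟_ ℕ._≟_) x arcs₄₈

triangleFree : TriangleFree
triangleFree u v w (uv , vw , uw) =
  All.lookup (All.lookup no-triangle (arc {u} {v} uv)) (arc {v} {w} vw) ≡.refl (arc {u} {w} uw)
  where
  arc : ∀ {u v} → Adj u v → (Fin.toℕ u , Fin.toℕ v) ∈ arcs₄₈
  arc (inj₁ uv) = ∈-++⁺ˡ uv
  arc (inj₂ vu) = ∈-++⁺ʳ edges₄₈ (∈-map⁺ swap vu)
  no-triangle : All (λ (a , b) → All (λ (c , d) → b ≡ c → ¬ (a , d) ∈ arcs₄₈) arcs₄₈) arcs₄₈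
  no-triangle = toWitness {a? = all? (λ (a , b) → all? (λ (c , d) →
    (b ℕ.≟ c) →-dec ¬? ((a , d) ∈arcs?)) arcs₄₈) arcs₄₈} _

-- The minimum cycle basis

square pentagon₁ pentagon₂ : Cycle G₄₈
square = record
  { vertices = # 0 ∷ # 1 ∷ # 12 ∷ # 2 ∷ []
  ; long = toWitness {a? = 3 ℕ.≤? 4} _ ; unique = toWitness {a? = unique? _} _
  ; steps = toWitness {a? = all? (λ (u , v) → adj? u v) _} _ }
pentagon₁ = record
  { vertices = # 11 ∷ # 14 ∷ # 26 ∷ # 27 ∷ # 15 ∷ []
  ; long = toWitness {a? = 3 ℕ.≤? 5} _ ; unique = toWitness {a? = unique? _} _
  ; steps = toWitness {a? = all? (λ (u , v) → adj? u v) _} _ }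
pentagon₂ = record
  { vertices = # 17 ∷ # 29 ∷ # 37 ∷ # 39 ∷ # 30 ∷ []
  ; long = toWitness {a? = 3 ℕ.≤? 5} _ ; unique = toWitness {a? = unique? _} _
  ; steps = toWitness {a? = all? (λ (u , v) → adj? u v) _} _ }

cycles₄₈ : List (Cycle G₄₈)
cycles₄₈ = square ∷ pentagon₁ ∷ pentagon₂ ∷ []

module _ where
  open CycleSpaceOf G₄₈ edgeList
  open EdgeList edgeList using (Edge)
  open 𝔽₂ using (combination; indicator)

  private
    b : Fin 3 → Vector Bool 50
    b i = edgesOf (stepsOf (lookup cycles₄₈ i))

    -- the edge of each cycle that is not in the spanning tree
    rep : Fin 3 → Edge
    rep = Vec.lookup (# 6 ∷ # 18 ∷ # 43 ∷ [])

    -- For a tree edge this is the set of vertices that its removal separates from the root, so the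
    -- cut is its fundamental cut. For one of the three edges outside the tree the set is empty, and
    -- the two terms of the cut condition cancel.
    belowEdge : Edge → Vector Bool 48
    belowEdge e v = edgesOf (pathToRoot 9 v) e

    cycleEdge : Fin 14 → Edge
    cycleEdge = Vec.lookup (
      # 0 ∷ # 4 ∷ # 6 ∷ # 1 ∷ # 17 ∷ # 21 ∷ # 33 ∷ # 22 ∷ # 18 ∷
      # 24 ∷ # 35 ∷ # 43 ∷ # 37 ∷ # 25 ∷ [])

    cycles-even : ∀ j → Even (b j)
    cycles-even = toWitness {a? = Fin.all? λ j → even? (b j)} _

  basis-edgeList : IsCycleBasisOf cycles₄₈
  basis-edgeList = isBasis b rep belowEdge
    (toWitness {a? = Fin.all? λ e → ¬? (proj₁ (lookup edgeList e) Fin.≟ proj₂ (lookup edgeList e))} _)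
    (toWitness {a? = Fin.all? λ e → Fin.all? λ f →
      (belowEdge e (proj₁ (lookup edgeList f)) xor belowEdge e (proj₂ (lookup edgeList f)))
      Bool.≟ (indicator e f xor combination (λ j → b j e) (indicator ∘ rep) f)} _)
    cycles-even
    (toWitness {a? = Fin.all? λ i → Fin.all? λ j → b j (rep i) Bool.≟ indicator i j} _)

  minimum-edgeList : IsMinimumCycleBasisOf cycles₄₈
  -- `totalLength` of the three cycles evaluates to 14, the number of edges listed by `cycleEdge`,
  -- so the lower bound is minimality itself.
  minimum-edgeList = basis-edgeList , totalLength-≥ cycleEdge
    (toWitness {a? = Fin.all? λ i → Fin.all? λ j → ¬? (i Fin.≟ j) →-dec
      (¬? (lookup edgeList (cycleEdge i) ≟ lookup edgeList (cycleEdge j))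
       ×-dec ¬? (lookup edgeList (cycleEdge i) ≟ swap (lookup edgeList (cycleEdge j))))} _)
    (λ i → let j , bji = covering i in b j , cycles-even j , bji)
    where
    _≟_ : (x y : Vertex × Vertex) → Dec (x ≡ y)
    _≟_ = ≡-dec Fin._≟_ Fin._≟_
    covering : ∀ i → ∃[ j ] b j (cycleEdge i) ≡ true
    covering = toWitness {a? = Fin.all? λ i → Fin.any? λ j → b j (cycleEdge i) Bool.≟ true} _

minimumCycleBasis : HasMinimumCycleBasisOfLengths G₄₈ (4 ∷ 5 ∷ 5 ∷ [])
minimumCycleBasis =
  cycles₄₈ , isMinimumCycleBasis G₄₈ (≡.sym edges≡edgeList) cycles₄₈ minimum-edgeList , ≡.refl

mainTheorem5 : Graph.Connected G₄₈
    × Graph.TriangleFree G₄₈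
    × Graph.maxDegree G₄₈ ≡ 4
    × Graph.cycleRank G₄₈ ≡ + 3
    × HasMinimumCycleBasisOfLengths G₄₈ (4 ∷ 5 ∷ 5 ∷ [])
    × Graph.order (lineGraph G₄₈) ≡ 50
    × ((ℝ : Reals) → Spectral.HasInertia ℝ (lineGraph G₄₈) (26 , 0 , 24)
    × Spectral.HasSignature ℝ (lineGraph G₄₈) (+ 2))
mainTheorem5 =
    connected , triangleFree , ≡.refl , ≡.refl , minimumCycleBasis , ≡.refl
  , λ ℝ → let positive , null , negative = inertia ℝ
          in (positive , null , negative) , (26 , 24 , positive , negative , ≡.refl)
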